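{- For $t\geq 2$, let $F_{2,t}(k)=1$ if $2\leq k\leq t+1$ and $F_{2,t}(k)=0$ otherwise. For $s\geq 3$ and $t\geq 2$, define $F_{s,t}(k)$ recursively by \[F_{s,t}(k)=\begin{cases} \displaystyle\sum_{i=s-1}^{k-1}F_{s-1,t}(i)\sum_{j=\max\{0,\,k-(s-2)t-2\}}^{t-1}\binom{k-i-1}{j}, & \text{if } s\leq k\leq(s-1)t+1; \\ 0, & \text{otherwise.} \end{cases}\] Then for all $s\ge2$ and $t\ge 2$, \[A_{321}(K_{s,t}^\beta)=\sum_{k=s}^{(s-1)t+1}\binom{st-k}{t-1}F_{s,t}(k).\]
   Context: The comb $K_{s,t}$ has elements $e_{i,j}$, $1\le i\le s$, $1\le j\le t$, with partial order generated by the covers $e_{i,1}\lessdot e_{i+1,1}$ ($1\le i\le s-1$) and $e_{i,j}\lessdot e_{i,j+1}$ ($1\le j\le t-1$). $K^\beta_{s,t}$ is the labeled poset on $[st]$ obtained by giving $e_{i,j}$ the label $(i-1)t+j$. A linear extension is a permutation of $[st]$ in which $x$ precedes $y$ whenever $x<y$ in the poset; $A_{321}(P)$ is the number of linear extensions of $P$ avoiding the pattern $321$. -}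

module Defs where

open import Data.Bool.Base using (if_then_else_)
open import Data.Fin.Base as Fin using (Fin; zero; suc; toℕ; remQuot; combine)
open import Data.Fin.Properties as Fin using (any?; all?)
open import Data.List.Base as List using (List; allFin; applyUpTo; cartesianProductWith; filter; length)
open import Data.Nat.Base using (ℕ; zero; suc; _+_; _*_; _∸_; _≤_; z≤n; s≤s)
open import Data.Nat.Combinatorics using (_C_)
open import Data.Nat.ListAction using (sum)
open import Data.Nat.Properties as ℕ using (_≟_; _≤?_)
open import Data.Product.Base using (_×_; _,_; ∃-syntax; uncurry)
open import Data.Sum.Base using (_⊎_; inj₁; inj₂)
open import Data.Vec.Base using (Vec; []; _∷_; lookup)
open import Data.Vec.Relation.Unary.AllPairs using (allPairs?)
open import Data.Vec.Relation.Unary.Unique.Propositional using (Unique)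
open import Function.Base using (_on_)
open import Level using (0ℓ)
open import Relation.Binary.Construct.Closure.ReflexiveTransitive as Star using (Star; ε; _◅_; _◅◅_)
import Relation.Binary.Construct.NonStrictToStrict as ToStrict
open import Relation.Binary.Core using (Rel)
open import Relation.Binary.Definitions using (Decidable; Antisymmetric)
open import Relation.Binary.PropositionalEquality
open import Relation.Binary.Structures using (IsDecPartialOrder)
open import Relation.Nullary using (¬_; Dec; does)
open import Relation.Nullary.Decidable using (map′; ¬?; _×-dec_; _⊎-dec_; _→-dec_)

-- A poset on [n].  Labels are 0-based: Fin n stands for {1, …, n} via x ↦ suc (toℕ x).

record LabeledPoset (n : ℕ) : Set₁ where
  infix 4 _⊑_
  field
    _⊑_               : Rel (Fin n) 0ℓ
    isDecPartialOrder : IsDecPartialOrder _≡_ _⊑_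

  open IsDecPartialOrder isDecPartialOrder public using () renaming (_≤?_ to _⊑?_)
  open ToStrict _≡_ _⊑_ public using () renaming (_<_ to _⊏_)

  _⊏?_ : Decidable _⊏_
  _⊏?_ = ToStrict.<-decidable _≡_ _⊑_ Fin._≟_ _⊑?_

-- Permutations of [n] are written in one-line notation, as words of length n
-- over [n] with pairwise distinct letters.

words : (n m : ℕ) → List (Vec (Fin n) m)
words n zero    = List.[ [] ]
words n (suc m) = cartesianProductWith _∷_ (allFin n) (words n m)

module _ {n : ℕ} where

  IsPermutation : Vec (Fin n) n → Set
  IsPermutation = Unique

  Precedes : Vec (Fin n) n → Rel (Fin n) 0ℓ
  Precedes w x y = ∃[ i ] ∃[ j ] i Fin.< j × lookup w i ≡ x × lookup w j ≡ y

  IsLinearExtension : LabeledPoset n → Vec (Fin n) n → Set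
  IsLinearExtension P w = IsPermutation w × (∀ x y → x ⊏ y → Precedes w x y)
    where open LabeledPoset P

  Contains321 : Vec (Fin n) n → Set
  Contains321 w = ∃[ i ] ∃[ j ] ∃[ k ]
    i Fin.< j × j Fin.< k × lookup w j Fin.< lookup w i × lookup w k Fin.< lookup w j

  isPermutation? : (w : Vec (Fin n) n) → Dec (IsPermutation w)
  isPermutation? = allPairs? λ x y → ¬? (x Fin.≟ y)

  precedes? : (w : Vec (Fin n) n) → Decidable (Precedes w)
  precedes? w x y = any? λ i → any? λ j →
    i Fin.<? j ×-dec lookup w i Fin.≟ x ×-dec lookup w j Fin.≟ y

  isLinearExtension? : (P : LabeledPoset n) (w : Vec (Fin n) n) → Dec (IsLinearExtension P w)
  isLinearExtension? P w =
    isPermutation? w ×-dec all? λ x → all? λ y → (x ⊏? y) →-dec precedes? w x y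
    where open LabeledPoset P

  contains321? : (w : Vec (Fin n) n) → Dec (Contains321 w)
  contains321? w = any? λ i → any? λ j → any? λ k →
    i Fin.<? j ×-dec j Fin.<? k ×-dec
    lookup w j Fin.<? lookup w i ×-dec lookup w k Fin.<? lookup w j

  A₃₂₁ : LabeledPoset n → ℕ
  A₃₂₁ P = length (filter (λ w → isLinearExtension? P w ×-dec ¬? (contains321? w)) (words n n))

-- The comb: the pair (i , j) of 0-based indices is the element e_{i+1,j+1}.

module Comb (s t : ℕ) where

  Element : Set
  Element = Fin s × Fin t

  infix 4 _⋖_ _≼_

  data _⋖_ : Rel Element 0ℓ where
    spine : ∀ {i i′ j} → toℕ j ≡ 0 → toℕ i′ ≡ suc (toℕ i) → (i , j) ⋖ (i′ , j)
    tooth : ∀ {i j j′} → toℕ j′ ≡ suc (toℕ j) → (i , j) ⋖ (i , j′)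

  _≼_ : Rel Element 0ℓ
  _≼_ = Star _⋖_

  -- An explicit description of ≼, used to decide it and to prove antisymmetry.

  Below : Rel Element 0ℓ
  Below (i , j) (i′ , j′) = (i ≡ i′ × toℕ j ≤ toℕ j′) ⊎ (toℕ j ≡ 0 × toℕ i ≤ toℕ i′)

  below? : Decidable Below
  below? (i , j) (i′ , j′) =
    (i Fin.≟ i′ ×-dec toℕ j ≤? toℕ j′) ⊎-dec (toℕ j ≟ 0 ×-dec toℕ i ≤? toℕ i′)

  ≼⇒Below : ∀ {x y} → x ≼ y → Below x y
  ≼⇒Below = Star.fold Below cons (inj₁ (refl , ℕ.≤-refl))
    where
    cons : ∀ {x y z} → x ⋖ y → Below y z → Below x z
    cons (spine j≡0 i′≡1+i) (inj₁ (refl , _))    = inj₂ (j≡0 , ℕ.<⇒≤ (ℕ.≤-reflexive (sym i′≡1+i)))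
    cons (spine j≡0 i′≡1+i) (inj₂ (_ , i′≤k))    = inj₂ (j≡0 , ℕ.<⇒≤ (subst (_≤ _) i′≡1+i i′≤k))
    cons (tooth j′≡1+j)     (inj₁ (i≡k , j′≤l))  = inj₁ (i≡k , ℕ.<⇒≤ (subst (_≤ _) j′≡1+j j′≤l))
    cons (tooth j′≡1+j)     (inj₂ (j′≡0 , _)) with () ← trans (sym j′≡1+j) j′≡0

  private
    chain : ∀ {n} (i j : Fin n) → toℕ i ≤ toℕ j → Star (λ a b → toℕ b ≡ suc (toℕ a)) i j
    chain zero    zero          _         = ε
    chain (suc i) (suc j)       (s≤s i≤j) = Star.gmap suc (cong suc) (chain i j i≤j)
    chain zero    (suc zero)    _         = refl ◅ ε
    chain zero    (suc (suc j)) _         = refl ◅ Star.gmap suc (cong suc) (chain zero (suc j) z≤n)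

  Below⇒≼ : ∀ {x y} → Below x y → x ≼ y
  Below⇒≼ {i , j} {_  , j′} (inj₁ (refl , j≤j′)) = Star.gmap (i ,_) tooth (chain j j′ j≤j′)
  Below⇒≼ {i , j} {i′ , j′} (inj₂ (j≡0 , i≤i′)) =
    Star.gmap (_, j) (spine j≡0) (chain i i′ i≤i′) ◅◅
    Star.gmap (i′ ,_) tooth (chain j j′ (subst (_≤ toℕ j′) (sym j≡0) z≤n))

  _≼?_ : Decidable _≼_
  x ≼? y = map′ Below⇒≼ ≼⇒Below (below? x y)

  ≼-antisym : Antisymmetric _≡_ _≼_
  ≼-antisym {i , j} {i′ , j′} p q with ≼⇒Below p | ≼⇒Below q
  ... | inj₁ (refl , j≤j′) | inj₁ (_ , j′≤j)      = cong (i ,_) (Fin.toℕ-injective (ℕ.≤-antisym j≤j′ j′≤j))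
  ... | inj₁ (refl , j≤j′) | inj₂ (j′≡0 , _)      = cong (i ,_) (Fin.toℕ-injective (ℕ.≤-antisym j≤j′ (subst (_≤ toℕ j) (sym j′≡0) z≤n)))
  ... | inj₂ (j≡0 , _)     | inj₁ (refl , j′≤j)   = cong (i ,_) (Fin.toℕ-injective (ℕ.≤-antisym (subst (_≤ toℕ j′) (sym j≡0) z≤n) j′≤j))
  ... | inj₂ (j≡0 , i≤i′)  | inj₂ (j′≡0 , i′≤i)   =
    cong₂ _,_ (Fin.toℕ-injective (ℕ.≤-antisym i≤i′ i′≤i)) (Fin.toℕ-injective (trans j≡0 (sym j′≡0)))

-- The labeling is (i , j) ↦ combine i j, with toℕ (combine i j) ≡ t * toℕ i + toℕ j;
-- remQuot t is its inverse.

Kᵝ : (s t : ℕ) → LabeledPoset (s * t)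
Kᵝ s t = record
  { _⊑_               = _≼_ on remQuot t
  ; isDecPartialOrder = record
    { isPartialOrder = record
      { isPreorder = record
        { isEquivalence = isEquivalence
        ; reflexive     = λ { refl → ε }
        ; trans         = _◅◅_
        }
      ; antisym = λ {x} {y} p q →
          trans (sym (Fin.combine-remQuot {s} t x))
            (trans (cong (uncurry combine) (≼-antisym p q)) (Fin.combine-remQuot {s} t y))
      }
    ; _≟_  = Fin._≟_
    ; _≤?_ = λ x y → remQuot t x ≼? remQuot t y
    }
  }
  where open Comb s t

-- ∑[ i ∈ a ⋯ b ] f i is the sum over a ≤ i ≤ b, both ends included; it is 0 when b < a.

∑ : ℕ → ℕ → (ℕ → ℕ) → ℕ
∑ a b f = sum (applyUpTo (λ d → f (a + d)) (suc b ∸ a))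

syntax ∑ a b (λ i → e) = ∑[ i ∈ a ⋯ b ] e

-- The cases s = 0 and s = 1 are junk values.  Truncated subtraction renders
-- max{0, k - (s-2)t - 2}; every other subtraction below is nonnegative.

F : (s t k : ℕ) → ℕ
F 0 t k = 0
F 1 t k = 0
F 2 t k = if does (2 ≤? k ×-dec k ≤? t + 1) then 1 else 0
F s@(suc s-1@(suc (suc _))) t k =
  if does (s ≤? k ×-dec k ≤? (s ∸ 1) * t + 1)
  then ∑[ i ∈ s ∸ 1 ⋯ k ∸ 1 ]
         (F s-1 t i * (∑[ j ∈ k ∸ ((s ∸ 2) * t + 2) ⋯ t ∸ 1 ] ((k ∸ i ∸ 1) C j)))
  else 0

{-# OPTIONS --safe #-}
module Submission where

open import Defs
open import Data.Bool.Base using (Bool; true; false; if_then_else_)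
open import Data.Fin.Base as Fin using (Fin; zero; suc; toℕ; fromℕ<; remQuot; combine)
open import Data.Fin.Properties using (toℕ<n; toℕ-fromℕ<; toℕ-injective; toℕ-combine; remQuot-combine; combine-remQuot)
open import Data.List.Base using (List; []; _∷_; _++_; [_]; length; map; filter; applyUpTo; upTo; cartesianProduct)
open import Data.List.Membership.Propositional using (_∈_; _∉_)
open import Data.List.Membership.Propositional.Properties
open import Data.List.Properties
open import Data.List.Relation.Binary.Sublist.Propositional using (_⊆_; []; _∷_; _∷ʳ_; ⊆-trans; from∈; to∈; minimum; lookup)
import Data.List.Relation.Binary.Sublist.Propositional.Properties as Sub
open import Data.List.Relation.Unary.All as All using (All; []; _∷_)
import Data.List.Relation.Unary.All.Properties as All
open import Data.List.Relation.Unary.AllPairs using (AllPairs; []; _∷_)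
import Data.List.Relation.Unary.AllPairs.Properties as AllPairs
open import Data.List.Relation.Unary.Any using (here; there)
open import Data.List.Relation.Unary.Unique.Propositional using (Unique)
import Data.List.Relation.Unary.Unique.Propositional.Properties as Unique
open import Data.Nat.Base
open import Data.Nat.Combinatorics using (_C_; nCk+nC[k+1]≡[n+1]C[k+1]; nCn≡1; k>n⇒nCk≡0)
open import Data.Nat.ListAction using (sum)
open import Data.Nat.Properties
open import Data.List.Membership.DecPropositional _≟_ using (_∈?_)
open import Data.Product.Base using (_×_; _,_; proj₁; proj₂; ∃-syntax; map₁)
open import Data.Sum.Base using (_⊎_; inj₁; inj₂)
open import Data.Vec.Base as Vec using (Vec; []; _∷_)
import Data.Vec.Properties as Vec
open import Data.Vec.Relation.Unary.All as VecAll using ([]; _∷_)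
open import Data.Vec.Relation.Unary.AllPairs using ([]; _∷_)
import Data.Vec.Relation.Unary.Unique.Propositional as Vec
open import Function.Base using (_∘_; id)
open import Relation.Binary.Definitions using (tri<; tri≈; tri>)
open import Relation.Binary.PropositionalEquality hiding ([_])
open import Relation.Nullary using (¬_; Dec; contradiction; yes; no; does)
open import Relation.Nullary.Decidable using (_×-dec_; ¬?; dec-true; dec-false)

-- Delete the labels of the last tooth from a 321-avoiding linear extension.  They are the
-- largest labels and occur in increasing order, so 321 is avoided exactly when the smaller
-- labels avoid it and those placed after the head of the last tooth increase.  Hence one counts
-- pairs (x , y) such that xy is a 321-avoiding linear extension of n teeth, x has length m and
-- contains all n heads, and y is increasing; there are F (n + 1) (m + 1) of them.  Adding a tooth
-- turns (x , y) into (x c Z , Y), where c is the new head, Z shuffles j of the other new labels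
-- with an initial part of y, and Y, being increasing, is forced.  There are ((m' - 1 - m) C j)
-- choices of Z when x c Z has length m', and j is bounded below because y must supply the other
-- letters of Z.  The recursion for F follows, and the final sum is its instance with Y empty.

-- Finite counting by explicit lists.

private
  variable
    A B : Set

-- Listing elements of `A` rather than proofs makes the count independent of how many proofs `P a`
-- has, and no decision procedure for `P` is asked for.
record Counted {A : Set} (P : A → Set) (n : ℕ) : Set where
  field
    elements : List A
    unique   : Unique elements
    sound    : ∀ {a} → a ∈ elements → P a
    complete : ∀ {a} → P a → a ∈ elements
    size     : length elements ≡ n

-- Pigeonhole, by deleting one occurrence of each letter of `xs` from `ys`. It serves for the
-- uniqueness of counts, the length of an extension and the surjectivity of a permutation.
unique-length-≤ : {xs ys : List A} → Unique xs → (∀ {a} → a ∈ xs → a ∈ ys) → length xs ≤ length ys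
unique-length-≤ {xs = []} _ _ = z≤n
unique-length-≤ {xs = x ∷ xs} (x∉ ∷ u) sub with ∈-∃++ (sub (here refl))
... | as , bs , refl = begin
  suc (length xs)               ≤⟨ s≤s (unique-length-≤ u sub′) ⟩
  suc (length (as ++ bs))       ≡⟨ cong suc (length-++ as) ⟩
  suc (length as + length bs)   ≡⟨ +-suc _ _ ⟨
  length as + suc (length bs)   ≡⟨ length-++ as ⟨
  length (as ++ x ∷ bs)         ∎
  where
  open ≤-Reasoning
  sub′ : ∀ {a} → a ∈ xs → a ∈ as ++ bs
  sub′ a∈xs with ∈-++⁻ as (sub (there a∈xs))
  ... | inj₁ a∈as         = ∈-++⁺ˡ a∈as
  ... | inj₂ (here refl)  = contradiction refl (All.lookup x∉ a∈xs)
  ... | inj₂ (there a∈bs) = ∈-++⁺ʳ as a∈bs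

counted-unique : {P : A → Set} {m n : ℕ} → Counted P m → Counted P n → m ≡ n
counted-unique c d = trans (sym C.size) (trans (≤-antisym
    (unique-length-≤ C.unique (D.complete ∘ C.sound))
    (unique-length-≤ D.unique (C.complete ∘ D.sound))) D.size)
  where
  module C = Counted c
  module D = Counted d

map-unique : (f : A → B) {xs : List A} → (∀ {a b} → a ∈ xs → b ∈ xs → f a ≡ f b → a ≡ b) →
             Unique xs → Unique (map f xs)
map-unique f inj []       = []
map-unique f inj (x∉ ∷ u) =
  All.map⁺ (All.tabulate λ a∈ → All.lookup x∉ a∈ ∘ inj (here refl) (there a∈))
  ∷ map-unique f (λ a∈ b∈ → inj (there a∈) (there b∈)) u

-- Injectivity is demanded only where `P` holds, because `insert` takes junk values elsewhere.
counted-map : {P : A → Set} {Q : B → Set} {n : ℕ} (f : A → B) →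
              (∀ {a} → P a → Q (f a)) →
              (∀ {a b} → P a → P b → f a ≡ f b → a ≡ b) →
              (∀ {b} → Q b → ∃[ a ] P a × f a ≡ b) →
              Counted P n → Counted Q n
counted-map {Q = Q} f image inj surj c = record
  { elements = map f elements
  ; unique   = map-unique f (λ a∈ b∈ → inj (sound a∈) (sound b∈)) unique
  ; sound    = λ b∈ → let a , a∈ , b≡fa = ∈-map⁻ f b∈ in subst Q (sym b≡fa) (image (sound a∈))
  ; complete = λ q → let a , p , fa≡b = surj q in subst (_∈ map f elements) fa≡b (∈-map⁺ f (complete p))
  ; size     = trans (length-map f elements) size
  }
  where open Counted c

counted-⇔ : {P Q : A → Set} {n : ℕ} → (∀ {a} → P a → Q a) → (∀ {a} → Q a → P a) →
            Counted P n → Counted Q n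
counted-⇔ to from c = record
  { elements = elements
  ; unique   = unique
  ; sound    = to ∘ sound
  ; complete = complete ∘ from
  ; size     = size
  }
  where open Counted c

counted-∅ : {P : A → Set} → (∀ {a} → ¬ P a) → Counted P 0
counted-∅ ¬p = record
  { elements = [] ; unique = [] ; sound = λ () ; complete = λ p → contradiction p ¬p ; size = refl }

counted-singleton : {P : A → Set} (a : A) → P a → (∀ {b} → P b → b ≡ a) → Counted P 1
counted-singleton {P = P} a p only = record
  { elements = [ a ]
  ; unique   = [] ∷ []
  ; sound    = λ { (here b≡a) → subst P (sym b≡a) p }
  ; complete = here ∘ only
  ; size     = refl
  }

counted-⊎ : {P Q : A → Set} {m n : ℕ} → (∀ {a} → P a → ¬ Q a) →
            Counted P m → Counted Q n → Counted (λ a → P a ⊎ Q a) (m + n)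
counted-⊎ {P = P} {Q} disjoint c d = record
  { elements = C.elements ++ D.elements
  ; unique   = Unique.++⁺ C.unique D.unique λ (a∈ , a∈′) → disjoint (C.sound a∈) (D.sound a∈′)
  ; sound    = sound′
  ; complete = λ { (inj₁ p) → ∈-++⁺ˡ (C.complete p) ; (inj₂ q) → ∈-++⁺ʳ C.elements (D.complete q) }
  ; size     = trans (length-++ C.elements) (cong₂ _+_ C.size D.size)
  }
  where
  module C = Counted c
  module D = Counted d
  sound′ : ∀ {a} → a ∈ C.elements ++ D.elements → P a ⊎ Q a
  sound′ a∈ with ∈-++⁻ C.elements a∈
  ... | inj₁ a∈C = inj₁ (C.sound a∈C)
  ... | inj₂ a∈D = inj₂ (D.sound a∈D)

length-cartesianProduct : (xs : List A) (ys : List B) →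
                          length (cartesianProduct xs ys) ≡ length xs * length ys
length-cartesianProduct []       ys = refl
length-cartesianProduct (x ∷ xs) ys =
  trans (length-++ (map (x ,_) ys)) (cong₂ _+_ (length-map (x ,_) ys) (length-cartesianProduct xs ys))

counted-× : {P : A → Set} {Q : B → Set} {m n : ℕ} → Counted P m → Counted Q n →
            Counted (λ (a , b) → P a × Q b) (m * n)
counted-× c d = record
  { elements = cartesianProduct C.elements D.elements
  ; unique   = Unique.cartesianProduct⁺ C.unique D.unique
  ; sound    = λ ab∈ → let a∈ , b∈ = ∈-cartesianProduct⁻ C.elements D.elements ab∈ in C.sound a∈ , D.sound b∈
  ; complete = λ (p , q) → ∈-cartesianProduct⁺ (C.complete p) (D.complete q)
  ; size     = trans (length-cartesianProduct C.elements D.elements) (cong₂ _*_ C.size D.size)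
  }
  where
  module C = Counted c
  module D = Counted d

counted-sum : (P : ℕ → A → Set) (c : ℕ → ℕ) (n : ℕ) →
              (∀ {i j a} → P i a → P j a → i ≡ j) →
              (∀ i → Counted (P i) (c i)) →
              Counted (λ a → ∃[ i ] i < n × P i a) (sum (applyUpTo c n))
counted-sum P c zero    disjoint counts = counted-∅ λ { (_ , () , _) }
counted-sum P c (suc n) disjoint counts = counted-⇔
  (λ { (inj₁ p) → 0 , z<s , p ; (inj₂ (i , i<n , p)) → suc i , s<s i<n , p })
  (λ { (zero , _ , p) → inj₁ p ; (suc i , s≤s i<n , p) → inj₂ (i , i<n , p) })
  (counted-⊎ (λ { p (i , _ , q) → contradiction (disjoint p q) λ () })
    (counts 0)
    (counted-sum (P ∘ suc) (c ∘ suc) n (λ p q → suc-injective (disjoint p q))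
      (counts ∘ suc)))

counted-∑ : (P : A → Set) (stat : A → ℕ) (c : ℕ → ℕ) (lo hi : ℕ) →
            (∀ k → Counted (λ a → P a × stat a ≡ k) (c k)) →
            Counted (λ a → P a × lo ≤ stat a × stat a ≤ hi) (∑ lo hi c)
counted-∑ P stat c lo hi counts = counted-⇔
  (λ (d , d<len , p , stat≡) → p , subst (lo ≤_) (sym stat≡) (m≤m+n lo d) ,
     subst (_≤ hi) (sym stat≡) (bound d<len))
  (λ {a} (p , lo≤ , ≤hi) → stat a ∸ lo , ∸-monoˡ-< (s≤s ≤hi) lo≤ , p , sym (m+[n∸m]≡n lo≤))
  (counted-sum (λ d a → P a × stat a ≡ lo + d) (λ d → c (lo + d)) (suc hi ∸ lo)
    (λ (_ , e) (_ , e′) → +-cancelˡ-≡ lo _ _ (trans (sym e) e′))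
    (counts ∘ (lo +_)))
  where
  bound : ∀ {d} → d < suc hi ∸ lo → lo + d ≤ hi
  bound {d} d<len = s≤s⁻¹ (subst (_≤ suc hi) (+-suc lo d)
    (≤-trans (+-monoʳ-≤ lo d<len) (≤-reflexive (m+[n∸m]≡n {lo} {suc hi} lo≤))))
    where
    -- The offset `d` lies below `suc hi ∸ lo`, so this difference is nonzero and the subtraction is
    -- not truncated.
    lo≤ : lo ≤ suc hi
    lo≤ = <⇒≤ (m∸n≢0⇒n<m λ e → contradiction (subst (d <_) e d<len) λ ())

-- Binary words and binomial coefficients.

trues : List Bool → ℕ
trues []          = 0
trues (true  ∷ b) = suc (trues b)
trues (false ∷ b) = trues b

falses : List Bool → ℕ
falses []          = 0
falses (true  ∷ b) = falses b
falses (false ∷ b) = suc (falses b)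

length-trues+falses : ∀ b → length b ≡ trues b + falses b
length-trues+falses []          = refl
length-trues+falses (true  ∷ b) = cong suc (length-trues+falses b)
length-trues+falses (false ∷ b) = trans (cong suc (length-trues+falses b)) (sym (+-suc (trues b) (falses b)))

-- Pascal's rule, according to the first letter. For `k = 0` only `false` can come first, and
-- `suc n C 0` computes to the same number as `n C 0`.
counted-binary : ∀ n k → Counted (λ b → length b ≡ n × trues b ≡ k) (n C k)
counted-binary zero zero    = counted-singleton [] (refl , refl) λ { {[]} _ → refl }
counted-binary zero (suc k) = counted-∅ λ { {[]} (_ , ()) }
counted-binary (suc n) zero = counted-map (false ∷_)
  (λ (e , e′) → cong suc e , e′)
  (λ _ _ → ∷-injectiveʳ)
  (λ { {false ∷ b} (refl , e) → b , (refl , e) , refl })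
  (counted-binary n zero)
counted-binary (suc n) (suc k) = subst (Counted _) (nCk+nC[k+1]≡[n+1]C[k+1] n k) (counted-⇔
  (λ { (inj₁ (b , (e , e′) , refl)) → cong suc e , cong suc e′
     ; (inj₂ (b , (e , e′) , refl)) → cong suc e , e′ })
  (λ { {true  ∷ b} (refl , refl) → inj₁ (b , (refl , refl) , refl)
     ; {false ∷ b} (refl , e)    → inj₂ (b , (refl , e) , refl) })
  (counted-⊎ (λ { (_ , _ , refl) (_ , _ , ()) })
    (starting true (counted-binary n k))
    (starting false (counted-binary n (suc k)))))
  where
  starting : ∀ {P : List Bool → Set} {c} x → Counted P c →
             Counted (λ b → ∃[ b′ ] P b′ × x ∷ b′ ≡ b) c
  starting x = counted-map (x ∷_) (λ p → _ , p , refl) (λ _ _ → ∷-injectiveʳ) id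

-- Relative positions of letters in a word.

unique-swap : {a b : A} {xs : List A} → Unique xs → a ∷ b ∷ [] ⊆ xs → ¬ b ∷ a ∷ [] ⊆ xs
unique-swap (_ ∷ u)   (_ ∷ʳ p)   (_ ∷ʳ q)   = unique-swap u p q
unique-swap (x∉ ∷ _)  (_ ∷ʳ p)   (refl ∷ q) = contradiction refl (All.lookup x∉ (to∈ (Sub.∷ˡ⁻ p)))
unique-swap (x∉ ∷ _)  (refl ∷ p) (_ ∷ʳ q)   = contradiction refl (All.lookup x∉ (to∈ (Sub.∷ˡ⁻ q)))
unique-swap (x∉ ∷ _)  (refl ∷ p) (refl ∷ q) = contradiction refl (All.lookup x∉ (to∈ p))

-- No `c` stands behind the displayed one, so a letter with a `c` after it lies in front of that
-- one. This is how older heads are found to lie in `x`.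
∈-before : ∀ (xs : List A) {ys} {a c} → c ∉ ys → a ∷ c ∷ [] ⊆ xs ++ c ∷ ys → a ∈ xs
∈-before []       c∉ (_ ∷ʳ p)   = contradiction (to∈ (Sub.∷ˡ⁻ p)) c∉
∈-before []       c∉ (refl ∷ p) = contradiction (to∈ p) c∉
∈-before (x ∷ xs) c∉ (_ ∷ʳ p)   = there (∈-before xs c∉ p)
∈-before (x ∷ xs) c∉ (refl ∷ p) = here refl

⊆-drop-∉ : ∀ (xs : List A) {ys as a} → a ∉ xs → a ∷ as ⊆ xs ++ ys → a ∷ as ⊆ ys
⊆-drop-∉ []       a∉ p          = p
⊆-drop-∉ (x ∷ xs) a∉ (_ ∷ʳ p)   = ⊆-drop-∉ xs (a∉ ∘ there) p
⊆-drop-∉ (x ∷ xs) a∉ (refl ∷ p) = contradiction (here refl) a∉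

-- Both sides are split at the first occurrence of `a`. This recovers `x` and `Z` from `x c Z`.
++-∷-injective : {a : A} {xs xs′ ys ys′ : List A} → a ∉ xs → a ∉ xs′ →
                 xs ++ a ∷ ys ≡ xs′ ++ a ∷ ys′ → xs ≡ xs′ × ys ≡ ys′
++-∷-injective {xs = []}     {[]}      _  _   eq   = refl , ∷-injectiveʳ eq
++-∷-injective {xs = []}     {_ ∷ _}   _  a∉′ refl = contradiction (here refl) a∉′
++-∷-injective {xs = _ ∷ _}  {[]}      a∉ _   refl = contradiction (here refl) a∉
++-∷-injective {xs = x ∷ xs} {y ∷ xs′} a∉ a∉′ eq with refl , eq′ ← ∷-injective eq =
  map₁ (cong (x ∷_)) (++-∷-injective (a∉ ∘ there) (a∉′ ∘ there) eq′)

-- Shuffles coded by binary words.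

module _ {A : Set} where

  -- Merge b y z Z Y: the word b selects an initial shuffle Z of y (false) and z (true),
  -- and Y is what remains of y followed by what remains of z.
  data Merge : (b : List Bool) (y z Z Y : List A) → Set where
    done  : ∀ {y z} → Merge [] y z [] (y ++ z)
    right : ∀ {b y z Z Y a} → Merge b y z Z Y → Merge (true ∷ b) y (a ∷ z) (a ∷ Z) Y
    left  : ∀ {b y z Z Y a} → Merge b y z Z Y → Merge (false ∷ b) (a ∷ y) z (a ∷ Z) Y

  merge : List Bool → List A → List A → List A × List A
  merge []          y       z       = [] , y ++ z
  merge (true ∷ b)  y       (a ∷ z) = map₁ (a ∷_) (merge b y z)
  merge (false ∷ b) (a ∷ y) z       = map₁ (a ∷_) (merge b y z)
  -- Junk values for words that ask for more letters than a list has; the bounds in `merge-correct`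
  -- exclude them.
  merge (true ∷ b)  y       []      = [] , []
  merge (false ∷ b) []      z       = [] , []

  merge-correct : ∀ b y z → falses b ≤ length y → trues b ≤ length z →
                  Merge b y z (proj₁ (merge b y z)) (proj₂ (merge b y z))
  merge-correct []          y       z       _       _       = done
  merge-correct (true ∷ b)  y       (a ∷ z) p       (s≤s q) = right (merge-correct b y z p q)
  merge-correct (false ∷ b) (a ∷ y) z       (s≤s p) q       = left (merge-correct b y z p q)

  Merge⇒merge : ∀ {b y z Z Y} → Merge b y z Z Y → merge b y z ≡ (Z , Y)
  Merge⇒merge done      = refl
  Merge⇒merge (right m) = cong (map₁ (_ ∷_)) (Merge⇒merge m)
  Merge⇒merge (left m)  = cong (map₁ (_ ∷_)) (Merge⇒merge m)

  falses≤ : ∀ {b y z Z Y} → Merge b y z Z Y → falses b ≤ length y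
  falses≤ done      = z≤n
  falses≤ (right m) = falses≤ m
  falses≤ (left m)  = s≤s (falses≤ m)

  trues≤ : ∀ {b y z Z Y} → Merge b y z Z Y → trues b ≤ length z
  trues≤ done      = z≤n
  trues≤ (right m) = s≤s (trues≤ m)
  trues≤ (left m)  = trues≤ m

  length-Merge : ∀ {b y z Z Y} → Merge b y z Z Y → length Z ≡ length b
  length-Merge done      = refl
  length-Merge (right m) = cong suc (length-Merge m)
  length-Merge (left m)  = cong suc (length-Merge m)

-- Increasing words.

Increasing : List ℕ → Set
Increasing = AllPairs _<_

increasing-unique : ∀ {xs} → Increasing xs → Unique xs
increasing-unique []       = []
increasing-unique (x< ∷ i) = All.map <⇒≢ x< ∷ increasing-unique i

increasing-⊆ : ∀ {xs a b} → Increasing xs → a < b → a ∈ xs → b ∈ xs → a ∷ b ∷ [] ⊆ xs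
increasing-⊆ (x< ∷ i) a<b (here refl) (here refl) = contradiction a<b (<-irrefl refl)
increasing-⊆ (x< ∷ i) a<b (here refl) (there b∈)  = refl ∷ from∈ b∈
increasing-⊆ (x< ∷ i) a<b (there a∈)  (here refl) = contradiction a<b (<-asym (All.lookup x< a∈))
increasing-⊆ (x< ∷ i) a<b (there a∈)  (there b∈)  = _ ∷ʳ increasing-⊆ i a<b a∈ b∈

no-inversion⇒increasing : ∀ {xs} → Unique xs → (∀ {a b} → a < b → ¬ b ∷ a ∷ [] ⊆ xs) → Increasing xs
no-inversion⇒increasing []       _ = []
no-inversion⇒increasing {x ∷ xs} (x∉ ∷ u) h =
  All.tabulate below ∷ no-inversion⇒increasing u (λ a<b p → h a<b (_ ∷ʳ p))
  where
  below : ∀ {a} → a ∈ xs → x < a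
  below {a} a∈ with <-cmp x a
  ... | tri< x<a _ _ = x<a
  ... | tri≈ _ x≡a _ = contradiction x≡a (All.lookup x∉ a∈)
  ... | tri> _ _ a<x = contradiction (refl ∷ from∈ a∈) (h a<x)

increasing⇒no-inversion : ∀ {xs} → Increasing xs → ∀ {a b} → a < b → ¬ b ∷ a ∷ [] ⊆ xs
increasing⇒no-inversion (_ ∷ i)  a<b (_ ∷ʳ p)   = increasing⇒no-inversion i a<b p
increasing⇒no-inversion (x< ∷ _) a<b (refl ∷ p) = <-asym a<b (All.lookup x< (to∈ p))

-- Both heads are the minimum of the same set, hence equal; neither recurs in its tail, so the tails
-- again have equal sets of letters.
increasing-≡ : ∀ {xs ys} → Increasing xs → Increasing ys →
               (∀ {a} → a ∈ xs → a ∈ ys) → (∀ {a} → a ∈ ys → a ∈ xs) → xs ≡ ys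
increasing-≡ {[]}     {[]}     _ _ _ _ = refl
increasing-≡ {[]}     {y ∷ ys} _ _ _ g with () ← g (here refl)
increasing-≡ {x ∷ xs} {[]}     _ _ f _ with () ← f (here refl)
increasing-≡ {x ∷ xs} {y ∷ ys} (x< ∷ i) (y< ∷ j) f g =
  cong₂ _∷_ x≡y (increasing-≡ i j (tail x< x≡y f) (tail y< (sym x≡y) g))
  where
  x≡y : x ≡ y
  x≡y with f (here refl) | g (here refl)
  ... | here x≡y | _        = x≡y
  ... | there _  | here y≡x = sym y≡x
  ... | there x∈ | there y∈ = contradiction (All.lookup x< y∈) (<-asym (All.lookup y< x∈))
  tail : ∀ {z w zs ws} → All (z <_) zs → z ≡ w → (∀ {a} → a ∈ z ∷ zs → a ∈ w ∷ ws) →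
         ∀ {a} → a ∈ zs → a ∈ ws
  tail z< z≡w h a∈ with h (there a∈)
  ... | there a∈′ = a∈′
  ... | here refl = contradiction (All.lookup z< a∈) (<-irrefl z≡w)

-- Splitting a word at a threshold label.

module Threshold (c : ℕ) where

  lo hi : List ℕ → List ℕ
  lo = filter (_<? c)
  hi = filter (c ≤?_)

  lo-small : ∀ {a xs} → a < c → lo (a ∷ xs) ≡ a ∷ lo xs
  lo-small = filter-accept (_<? c)

  lo-big : ∀ {a xs} → c ≤ a → lo (a ∷ xs) ≡ lo xs
  lo-big = filter-reject (_<? c) ∘ ≤⇒≯

  hi-small : ∀ {a xs} → a < c → hi (a ∷ xs) ≡ hi xs
  hi-small = filter-reject (c ≤?_) ∘ <⇒≱

  hi-big : ∀ {a xs} → c ≤ a → hi (a ∷ xs) ≡ a ∷ hi xs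
  hi-big = filter-accept (c ≤?_)

  lo-all : ∀ {xs} → All (_< c) xs → lo xs ≡ xs
  lo-all = filter-all (_<? c)

  lo-none : ∀ {xs} → All (c ≤_) xs → lo xs ≡ []
  lo-none = filter-none (_<? c) ∘ All.map ≤⇒≯

  hi-all : ∀ {xs} → All (c ≤_) xs → hi xs ≡ xs
  hi-all = filter-all (c ≤?_)

  hi-none : ∀ {xs} → All (_< c) xs → hi xs ≡ []
  hi-none = filter-none (c ≤?_) ∘ All.map <⇒≱

  lo-⊆ : ∀ xs → lo xs ⊆ xs
  lo-⊆ = Sub.filter-⊆ (_<? c)

  hi-⊆ : ∀ xs → hi xs ⊆ xs
  hi-⊆ = Sub.filter-⊆ (c ≤?_)

  ⊆-lo : ∀ {xs ys} → All (_< c) xs → xs ⊆ ys → xs ⊆ lo ys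
  ⊆-lo all p = subst (_⊆ _) (lo-all all) (Sub.filter⁺ (_<? c) (_<? c) (λ { refl → id }) p)

  ⊆-hi : ∀ {xs ys} → All (c ≤_) xs → xs ⊆ ys → xs ⊆ hi ys
  ⊆-hi all p = subst (_⊆ _) (hi-all all) (Sub.filter⁺ (c ≤?_) (c ≤?_) (λ { refl → id }) p)

  lo-hi-split : ∀ {xs} → Increasing xs → xs ≡ lo xs ++ hi xs
  lo-hi-split []                = refl
  lo-hi-split {x ∷ xs} (x< ∷ i) with x <? c
  ... | yes x<c = trans (cong (x ∷_) (lo-hi-split i))
                        (sym (cong₂ _++_ (lo-small {x} {xs} x<c) (hi-small {x} {xs} x<c)))
  ... | no  x≮c = sym (cong₂ _++_ (lo-none all-big) (hi-all all-big))
    where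
    all-big : All (c ≤_) (x ∷ xs)
    all-big = ≮⇒≥ x≮c ∷ All.map (≤-trans (≮⇒≥ x≮c) ∘ <⇒≤) x<

  -- Equal letters lie on the same side of `c`, so a repetition would survive in one of the two
  -- subwords.
  lo-hi-unique : ∀ {xs} → Unique (lo xs) → Unique (hi xs) → Unique xs
  lo-hi-unique {[]}     _ _ = []
  lo-hi-unique {x ∷ xs} u v with x <? c
  ... | yes x<c with x∉ ∷ u′ ← subst Unique (lo-small x<c) u =
    All.tabulate (λ { a∈ refl → All.lookup x∉ (∈-filter⁺ (_<? c) a∈ x<c) refl })
    ∷ lo-hi-unique u′ (subst Unique (hi-small x<c) v)
  ... | no x≮c with x∉ ∷ v′ ← subst Unique (hi-big (≮⇒≥ x≮c)) v =
    All.tabulate (λ { a∈ refl → All.lookup x∉ (∈-filter⁺ (c ≤?_) a∈ (≮⇒≥ x≮c)) refl })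
    ∷ lo-hi-unique (subst Unique (lo-big (≮⇒≥ x≮c)) u) v′

  -- All letters of `y` are below `c` and none of `z` is, so filtering undoes the shuffle.
  lo-Merge : ∀ {b y z Z Y} → All (_< c) y → All (c ≤_) z → Merge b y z Z Y → lo (Z ++ Y) ≡ y
  lo-Merge {y = y} {z} py pz done =
    trans (filter-++ (_<? c) y z) (trans (cong₂ _++_ (lo-all py) (lo-none pz)) (++-identityʳ y))
  lo-Merge py       (pa ∷ pz) (right m) = trans (lo-big pa) (lo-Merge py pz m)
  lo-Merge (pa ∷ py) pz       (left m)  = trans (lo-small pa) (cong (_ ∷_) (lo-Merge py pz m))

  hi-Merge : ∀ {b y z Z Y} → All (_< c) y → All (c ≤_) z → Merge b y z Z Y → hi (Z ++ Y) ≡ z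
  hi-Merge {y = y} {z} py pz done =
    trans (filter-++ (c ≤?_) y z) (cong₂ _++_ (hi-none py) (hi-all pz))
  hi-Merge py       (pa ∷ pz) (right m) = trans (hi-big pa) (cong (_ ∷_) (hi-Merge py pz m))
  hi-Merge (pa ∷ py) pz       (left m)  = trans (hi-small pa) (hi-Merge py pz m)

  increasing-Merge : ∀ {b y z Z Y} → All (_< c) y → All (c ≤_) z → Increasing y → Increasing z →
                     Merge b y z Z Y → Increasing Y
  increasing-Merge py pz iy iz done =
    AllPairs.++⁺ iy iz (All.map (λ a<c → All.map (<-≤-trans a<c) pz) py)
  increasing-Merge py (_ ∷ pz) iy (_ ∷ iz) (right m) = increasing-Merge py pz iy iz m
  increasing-Merge (_ ∷ py) pz (_ ∷ iy) iz (left m)  = increasing-Merge py pz iy iz m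

  -- A letter of `Z` was taken from `z` exactly when it is at least `c`, so the shuffle word can be
  -- read off `Z`.
  bits-Merge : ∀ {b y z Z Y} → All (_< c) y → All (c ≤_) z → Merge b y z Z Y →
               b ≡ map (does ∘ (c ≤?_)) Z
  bits-Merge py       pz        done      = refl
  bits-Merge py       (pa ∷ pz) (right m) = cong₂ _∷_ (sym (dec-true (c ≤? _) pa)) (bits-Merge py pz m)
  bits-Merge (pa ∷ py) pz       (left m)  = cong₂ _∷_ (sym (dec-false (c ≤? _) (<⇒≱ pa))) (bits-Merge py pz m)

  Merge-injective : ∀ {b b′ y y′ z Z Y} → All (_< c) y → All (_< c) y′ → All (c ≤_) z →
                    Merge b y z Z Y → Merge b′ y′ z Z Y → b ≡ b′ × y ≡ y′
  Merge-injective p p′ q m m′ =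
    trans (bits-Merge p q m) (sym (bits-Merge p′ q m′)) ,
    trans (sym (lo-Merge p q m)) (lo-Merge p′ q m′)

  -- Comparing each letter of `Z` with `c` gives its bit. Once `Z` is used up, the increasing rest
  -- consists of its small letters followed by its big ones, as `done` requires.
  Merge-surjective : ∀ Z Y → Increasing Y → ∃[ b ] Merge b (lo (Z ++ Y)) (hi (Z ++ Y)) Z Y
  Merge-surjective [] Y iY =
    [] , subst (Merge [] (lo Y) (hi Y) []) (sym (lo-hi-split iY)) done
  Merge-surjective (a ∷ Z) Y iY with b , m ← Merge-surjective Z Y iY | a <? c
  ... | yes a<c rewrite lo-small {a} {Z ++ Y} a<c | hi-small {a} {Z ++ Y} a<c = false ∷ b , left m
  ... | no  a≮c rewrite lo-big {a} {Z ++ Y} (≮⇒≥ a≮c) | hi-big {a} {Z ++ Y} (≮⇒≥ a≮c) = true ∷ b , right m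

-- The comb on natural-number labels and its cut extensions.

module Teeth (r : ℕ) where

  t : ℕ
  t = suc r

  infix 4 _◁_

  -- The strict order of the comb, the label i * t + j standing for e_{i+1,j+1}.
  data _◁_ : ℕ → ℕ → Set where
    tooth : ∀ i {j j′} → j < j′ → j′ < t → i * t + j ◁ i * t + j′
    spine : ∀ {i i′ j′} → i < i′ → j′ < t → i * t ◁ i′ * t + j′

  *t-mono : ∀ {i i′} → i < i′ → i * t + t ≤ i′ * t
  *t-mono {i} i<i′ = ≤-trans (≤-reflexive (+-comm (i * t) t)) (*-monoˡ-≤ t i<i′)

  *t-mono-< : ∀ {i i′} → i < i′ → i * t < i′ * t
  *t-mono-< = *-monoˡ-< t

  ◁⇒< : ∀ {a b} → a ◁ b → a < b
  ◁⇒< (tooth i j<j′ _)      = +-monoʳ-< (i * t) j<j′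
  ◁⇒< (spine {i′ = i′} i<i′ _) = <-≤-trans (*t-mono-< i<i′) (m≤m+n (i′ * t) _)

  -- A tooth is a block of `t` consecutive labels and `n * t` starts a block, so no `tooth` relation
  -- crosses it; a `spine` relation starts at a head. Hence older teeth constrain a new one only
  -- through their heads.
  ◁-cross : ∀ {n a b} → a ◁ b → a < n * t → n * t ≤ b → ∃[ i ] i < n × a ≡ i * t
  ◁-cross {n} (tooth i {j} {j′} _ j′<t) a<nt nt≤b = contradiction nt≤b
    (<⇒≱ (<-≤-trans (+-monoʳ-< (i * t) j′<t)
      (*t-mono (*-cancelʳ-< t i n (≤-<-trans (m≤m+n (i * t) j) a<nt)))))
  ◁-cross {n} (spine {i} _ _) a<nt _ = i , *-cancelʳ-< t i n a<nt , refl

  ◁-tooth : ∀ n {a b} → n * t ≤ a → a < b → b < suc n * t → a ◁ b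
  ◁-tooth n {a} {b} nt≤a a<b b<nt+t = subst₂ _◁_ (m+[n∸m]≡n nt≤a) (m+[n∸m]≡n nt≤b)
    (tooth n (∸-monoˡ-< a<b nt≤a)
      (+-cancelˡ-< (n * t) _ _ (subst₂ _<_ (sym (m+[n∸m]≡n nt≤b)) (+-comm t (n * t)) b<nt+t)))
    where
    nt≤b : n * t ≤ b
    nt≤b = ≤-trans nt≤a (<⇒≤ a<b)

  ◁-spine : ∀ {i n} → i < n → i * t ◁ n * t
  ◁-spine {i} {n} i<n = subst (i * t ◁_) (+-identityʳ (n * t)) (spine i<n z<s)

  -- Words are lists of natural numbers, so that `n` can change without coercing letters. `order`
  -- bounds only `b`, since `◁⇒<` then bounds `a`.
  record Extension (n : ℕ) (w : List ℕ) : Set where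
    field
      unique  : Unique w
      bounded : ∀ {a} → a ∈ w → a < n * t
      covers  : ∀ {a} → a < n * t → a ∈ w
      order   : ∀ {a b} → a ◁ b → b < n * t → a ∷ b ∷ [] ⊆ w
      avoid   : ∀ {a b c} → b < a → c < b → ¬ a ∷ b ∷ c ∷ [] ⊆ w

    size : length w ≡ n * t
    size = trans (≤-antisym
        (unique-length-≤ unique (∈-upTo⁺ ∘ bounded))
        (unique-length-≤ (Unique.upTo⁺ (n * t)) (covers ∘ ∈-upTo⁻)))
      (length-applyUpTo id (n * t))

  -- `heads` lets the next tooth start directly after `x`, as its head must follow all earlier
  -- heads. `increasing` excludes a descent behind that head, which exceeds all old labels.
  record Cut (n m : ℕ) (xy : List ℕ × List ℕ) : Set where
    constructor mkCut
    x = proj₁ xy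
    y = proj₂ xy
    field
      extension  : Extension n (x ++ y)
      increasing : Increasing y
      cut        : length x ≡ m
      heads      : ∀ {i} → i < n → i * t ∈ x

  -- Adding one tooth to a cut.

  module Step (n : ℕ) where

    -- Both the head of the new tooth and the threshold between old and new labels.
    c : ℕ
    c = n * t

    open Threshold c public

    teeth : List ℕ
    teeth = applyUpTo (λ j → c + suc j) r

    increasing-tooth : Increasing (c ∷ teeth)
    increasing-tooth =
      All.applyUpTo⁺₂ _ r (λ j → m<m+n c z<s)
      ∷ AllPairs.applyUpTo⁺₁ _ r (λ i<j _ → +-monoʳ-< c (s<s i<j))

    teeth-big : All (c ≤_) teeth
    teeth-big with c< ∷ _ ← increasing-tooth = All.map <⇒≤ c<

    c∉teeth : c ∉ teeth
    c∉teeth c∈ with c< ∷ _ ← increasing-tooth = <-irrefl refl (All.lookup c< c∈)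

    ∈-tooth⁺ : ∀ {a} → c ≤ a → a < suc n * t → a ∈ c ∷ teeth
    ∈-tooth⁺ {a} c≤a a< with a ∸ c in eq | m+[n∸m]≡n c≤a
    ... | zero  | c+0≡a  = here (trans (sym c+0≡a) (+-identityʳ c))
    ... | suc j | c+1+j≡a = there (subst (_∈ teeth) c+1+j≡a (∈-applyUpTo⁺ _ (s<s⁻¹
      (+-cancelˡ-< c _ _ (subst₂ _<_ (sym c+1+j≡a) (+-comm t c) a<)))))

    ∈-tooth⁻ : ∀ {a} → a ∈ c ∷ teeth → c ≤ a × a < suc n * t
    ∈-tooth⁻ (here refl) = ≤-refl , m<n+m c z<s
    ∈-tooth⁻ (there a∈) with j , j<r , refl ← ∈-applyUpTo⁻ _ a∈ =
      m≤m+n c (suc j) , subst (c + suc j <_) (+-comm c t) (+-monoʳ-< c (s<s j<r))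

    small⇒bounded : ∀ {a} → a < c → a < suc n * t
    small⇒bounded a<c = <-≤-trans a<c (m≤n+m c t)

    extension-lo : ∀ {w} → Extension (suc n) w → Extension n (lo w)
    extension-lo {w} E = record
      { unique  = Unique.filter⁺ (_<? c) unique
      ; bounded = proj₂ ∘ ∈-filter⁻ (_<? c) {xs = w}
      ; covers  = λ a<c → ∈-filter⁺ (_<? c) (covers (small⇒bounded a<c)) a<c
      ; order   = λ a◁b b<c → ⊆-lo (<-trans (◁⇒< a◁b) b<c ∷ b<c ∷ []) (order a◁b (small⇒bounded b<c))
      ; avoid   = λ b<a c<b p → avoid b<a c<b (⊆-trans p (lo-⊆ w))
      }
      where open Extension E

    -- The new tooth is a chain, so an inversion among its letters would contradict `order`; an
    -- increasing word is determined by its set of letters.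
    extension-hi : ∀ {w} → Extension (suc n) w → hi w ≡ c ∷ teeth
    extension-hi {w} E = increasing-≡
      (no-inversion⇒increasing unique-hi λ {a} {b} a<b p →
        let b< = bound∈ (lookup p (here refl))
            c≤a = big∈ (lookup p (there (here refl)))
        in unique-swap unique (order (◁-tooth n c≤a a<b b<) b<) (⊆-trans p (hi-⊆ w)))
      increasing-tooth
      (λ a∈ → ∈-tooth⁺ (big∈ a∈) (bound∈ a∈))
      (λ a∈ → let c≤a , a< = ∈-tooth⁻ a∈ in ∈-filter⁺ (c ≤?_) (covers a<) c≤a)
      where
      open Extension E
      unique-hi : Unique (hi w)
      unique-hi = Unique.filter⁺ (c ≤?_) unique
      big∈ : ∀ {a} → a ∈ hi w → c ≤ a
      big∈ = proj₂ ∘ ∈-filter⁻ (c ≤?_) {xs = w}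
      bound∈ : ∀ {a} → a ∈ hi w → a < suc n * t
      bound∈ = bounded ∘ proj₁ ∘ ∈-filter⁻ (c ≤?_) {xs = w}

    lo-∷ : ∀ x v → All (_< c) x → lo (x ++ c ∷ v) ≡ x ++ lo v
    lo-∷ x v px = trans (filter-++ (_<? c) x (c ∷ v)) (cong₂ _++_ (lo-all px) (lo-big ≤-refl))

    hi-∷ : ∀ x v → All (_< c) x → hi (x ++ c ∷ v) ≡ c ∷ hi v
    hi-∷ x v px = trans (filter-++ (c ≤?_) x (c ∷ v)) (cong₂ _++_ (hi-none px) (hi-big ≤-refl))

    -- Converse to `extension-lo` and `extension-hi`: what these extract, together with the heads in
    -- `x` and the increase of `lo v`, suffices to rebuild the extension.
    extension-insert : ∀ x v → All (_< c) x → (∀ {i} → i < n → i * t ∈ x) →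
                       Extension n (x ++ lo v) → Increasing (lo v) → hi v ≡ teeth →
                       Extension (suc n) (x ++ c ∷ v)
    extension-insert x v px heads E iv hi≡ = record
      { unique  = lo-hi-unique (subst Unique (sym lo≡) E.unique)
                               (subst Unique (sym hi≡′) (increasing-unique increasing-tooth))
      ; bounded = bounded
      ; covers  = covers
      ; order   = order
      ; avoid   = avoid
      }
      where
      module E = Extension E
      w : List ℕ
      w = x ++ c ∷ v
      lo≡ : lo w ≡ x ++ lo v
      lo≡ = lo-∷ x v px
      hi≡′ : hi w ≡ c ∷ teeth
      hi≡′ = trans (hi-∷ x v px) (cong (c ∷_) hi≡)
      lo⊆ : x ++ lo v ⊆ w
      lo⊆ = subst (_⊆ w) lo≡ (lo-⊆ w)
      hi⊆ : c ∷ teeth ⊆ w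
      hi⊆ = subst (_⊆ w) hi≡′ (hi-⊆ w)
      bounded : ∀ {a} → a ∈ w → a < suc n * t
      bounded {a} a∈ with a <? c
      ... | yes a<c = small⇒bounded a<c
      ... | no  a≮c = proj₂ (∈-tooth⁻ (subst (a ∈_) hi≡′ (∈-filter⁺ (c ≤?_) a∈ (≮⇒≥ a≮c))))
      covers : ∀ {a} → a < suc n * t → a ∈ w
      covers {a} a< with a <? c
      ... | yes a<c = lookup lo⊆ (E.covers a<c)
      ... | no  a≮c = lookup hi⊆ (∈-tooth⁺ (≮⇒≥ a≮c) a<)
      order : ∀ {a b} → a ◁ b → b < suc n * t → a ∷ b ∷ [] ⊆ w
      order {a} {b} a◁b b< with b <? c | a <? c
      ... | yes b<c | _       = ⊆-trans (E.order a◁b b<c) lo⊆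
      ... | no  b≮c | no a≮c  = ⊆-trans (increasing-⊆ increasing-tooth (◁⇒< a◁b)
          (∈-tooth⁺ (≮⇒≥ a≮c) (<-trans (◁⇒< a◁b) b<)) (∈-tooth⁺ (≮⇒≥ b≮c) b<)) hi⊆
      -- Here `a` must be a head, which lies in `x`, while `b` belongs to the new tooth and so lies
      -- in `c ∷ v`.
      ... | no  b≮c | yes a<c with i , i<n , refl ← ◁-cross {n} a◁b a<c (≮⇒≥ b≮c) =
        Sub.++⁺ (from∈ (heads i<n)) (⊆-trans (from∈ (∈-tooth⁺ (≮⇒≥ b≮c) b<))
          (refl ∷ subst (_⊆ v) hi≡ (hi-⊆ v)))
      avoid : ∀ {a b d} → b < a → d < b → ¬ a ∷ b ∷ d ∷ [] ⊆ w
      -- If `a` is small, so are all three letters. If `a` and `b` are big, they form a descent of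
      -- the tooth. If only `a` is big, it is not in `x`, so `b` and `d` form a descent of `lo v`.
      avoid {a} {b} {d} b<a d<b p with a <? c | b <? c
      ... | yes a<c | _ = E.avoid b<a d<b (subst (_ ⊆_) lo≡
        (⊆-lo (a<c ∷ <-trans b<a a<c ∷ <-trans d<b (<-trans b<a a<c) ∷ []) p))
      ... | no a≮c | no b≮c = increasing⇒no-inversion increasing-tooth b<a (subst (_ ⊆_) hi≡′
        (⊆-hi (≮⇒≥ a≮c ∷ ≮⇒≥ b≮c ∷ []) (⊆-trans (refl ∷ refl ∷ minimum _) p)))
      ... | no a≮c | yes b<c = increasing⇒no-inversion iv d<b
        (⊆-lo (b<c ∷ <-trans d<b b<c ∷ []) (Sub.∷⁻ (⊆-drop-∉ x (λ a∈ → a≮c (All.lookup px a∈)) p)))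

    cut-small : ∀ {m xy} → Cut n m xy → All (_< c) (proj₁ xy) × All (_< c) (proj₂ xy)
    cut-small {xy = x , y} K = All.tabulate (bounded ∘ ∈-++⁺ˡ) , All.tabulate (bounded ∘ ∈-++⁺ʳ x)
      where open Extension (Cut.extension K)

    insert : (List ℕ × List ℕ) × List Bool → List ℕ × List ℕ
    insert ((x , y) , b) = x ++ c ∷ proj₁ (merge b y teeth) , proj₂ (merge b y teeth)

    -- Here `m` is the length of `x` and `Z` together. As `x` and `y` have `c` letters in all,
    -- `m ∸ c ≤ trues b` says that `y` can supply the `false` letters; `trues b ≤ r` says the same
    -- of the new tooth without its head.
    Insertable : ℕ → ℕ → (List ℕ × List ℕ) × List Bool → Set
    Insertable m i (xy , b) = Cut n i xy × length b ≡ m ∸ i × m ∸ c ≤ trues b × trues b ≤ r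

    insertable-Merge : ∀ {m i} x y b → i ≤ m → Insertable m i ((x , y) , b) →
                       Merge b y teeth (proj₁ (merge b y teeth)) (proj₂ (merge b y teeth))
    insertable-Merge {m} {i} x y b i≤m (K , |b|≡ , lower , upper) =
      merge-correct b y teeth falses≤y (≤-trans upper (≤-reflexive (sym (length-applyUpTo _ r))))
      where
      open ≤-Reasoning
      open Cut K using (extension; cut)
      falses≤y : falses b ≤ length y
      -- Adding `i + trues b` to both sides turns the left one into `m` and the right one into
      -- `c + trues b`.
      falses≤y = +-cancelˡ-≤ (i + trues b) _ _ (begin
        i + trues b + falses b   ≡⟨ +-assoc i _ _ ⟩
        i + (trues b + falses b) ≡⟨ cong (i +_) (length-trues+falses b) ⟨
        i + length b             ≡⟨ cong (i +_) |b|≡ ⟩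
        i + (m ∸ i)              ≡⟨ m+[n∸m]≡n i≤m ⟩
        m                        ≤⟨ m≤n+m∸n m c ⟩
        c + (m ∸ c)              ≤⟨ +-monoʳ-≤ c lower ⟩
        c + trues b              ≡⟨ cong (_+ trues b) (Extension.size extension) ⟨
        length (x ++ y) + trues b    ≡⟨ cong (_+ trues b) (length-++ x) ⟩
        length x + length y + trues b ≡⟨ cong (λ l → l + length y + trues b) cut ⟩
        i + length y + trues b   ≡⟨ +-assoc i _ _ ⟩
        i + (length y + trues b) ≡⟨ cong (i +_) (+-comm (length y) _) ⟩
        i + (trues b + length y) ≡⟨ +-assoc i _ _ ⟨
        i + trues b + length y   ∎)

    insert-cut : ∀ {m i} xyb → i ≤ m → Insertable m i xyb → Cut (suc n) (suc m) (insert xyb)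
    insert-cut {m} {i} ((x , y) , b) i≤m I@(K , |b|≡ , _) = record
      { extension  = subst (Extension (suc n)) (sym (++-assoc x (c ∷ Z) Y))
          (extension-insert x (Z ++ Y) px heads
            (subst (λ u → Extension n (x ++ u)) (sym lo≡) extension)
            (subst Increasing (sym lo≡) increasing)
            (hi-Merge py teeth-big M))
      ; increasing = increasing-Merge py teeth-big increasing increasing-teeth M
      ; cut        = begin
          length (x ++ c ∷ Z)       ≡⟨ length-++ x ⟩
          length x + suc (length Z) ≡⟨ +-suc _ _ ⟩
          suc (length x + length Z) ≡⟨ cong suc (cong₂ _+_ cut (trans (length-Merge M) |b|≡)) ⟩
          suc (i + (m ∸ i))         ≡⟨ cong suc (m+[n∸m]≡n i≤m) ⟩
          suc m                     ∎
      ; heads      = heads′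
      }
      where
      open ≡-Reasoning
      open Cut K using (extension; increasing; cut; heads)
      Z = proj₁ (merge b y teeth)
      Y = proj₂ (merge b y teeth)
      px = proj₁ (cut-small K)
      py = proj₂ (cut-small K)
      M = insertable-Merge x y b i≤m I
      lo≡ = lo-Merge {b} py teeth-big M
      increasing-teeth : Increasing teeth
      increasing-teeth with _ ∷ i ← increasing-tooth = i
      heads′ : ∀ {k} → k < suc n → k * t ∈ x ++ c ∷ Z
      heads′ k≤n with m≤n⇒m<n∨m≡n (s≤s⁻¹ k≤n)
      ... | inj₁ k<n  = ∈-++⁺ˡ (heads k<n)
      ... | inj₂ refl = ∈-insert x

    -- The letters of `x` are below `c`, so `c` marks where `x` ends; `Merge-injective` then gives
    -- back `y` and `b`. The lengths `i` and `j` may differ a priori, since all lengths are counted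
    -- together.
    insert-injective : ∀ {m i j} p q → i ≤ m → j ≤ m → Insertable m i p → Insertable m j q →
                       insert p ≡ insert q → p ≡ q
    insert-injective ((x , y) , b) ((x′ , y′) , b′) i≤m j≤m I@(K , _) J@(K′ , _) eq =
      go (++-∷-injective (c∉ K) (c∉ K′) (cong proj₁ eq)) (cong proj₂ eq)
         (insertable-Merge x y b i≤m I) (insertable-Merge x′ y′ b′ j≤m J)
      where
      c∉ : ∀ {m xy} → Cut n m xy → c ∉ proj₁ xy
      c∉ K c∈ = <-irrefl refl (All.lookup (proj₁ (cut-small K)) c∈)
      go : ∀ {Z Z′ Y Y′} → x ≡ x′ × Z ≡ Z′ → Y ≡ Y′ → Merge b y teeth Z Y → Merge b′ y′ teeth Z′ Y′ →
           ((x , y) , b) ≡ ((x′ , y′) , b′)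
      go (refl , refl) refl M M′ with refl , refl ←
        Merge-injective (proj₂ (cut-small K)) (proj₂ (cut-small K′)) teeth-big M M′ = refl

    -- Cutting `X` at the new head gives `x` and `Z`; `y` collects the old labels behind that head,
    -- and `b` records which letters of `Z` are new.
    insert-surjective : ∀ {m xy} → Cut (suc n) (suc m) xy →
                        ∃[ p ] (∃[ i ] i < suc m × Insertable m i p) × insert p ≡ xy
    insert-surjective {m} {X , Y} K with ∈-∃++ (Cut.heads K (n<1+n n))
    ... | x , Z , refl =
      ((x , y) , b) ,
      (length x , s≤s |x|≤m , (mkCut E′ iy refl heads′ , |b|≡ , lower , upper)) ,
      cong₂ _,_ (cong (λ u → x ++ c ∷ proj₁ u) (Merge⇒merge M)) (cong proj₂ (Merge⇒merge M))
      where
      open Cut K using (increasing; cut; heads)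
      v : List ℕ
      v = Z ++ Y
      E : Extension (suc n) (x ++ c ∷ v)
      E = subst (Extension (suc n)) (++-assoc x (c ∷ Z) Y) (Cut.extension K)
      module E = Extension E
      hi-w : hi x ++ c ∷ hi v ≡ c ∷ teeth
      hi-w = trans (sym (trans (filter-++ (c ≤?_) x (c ∷ v)) (cong (hi x ++_) (hi-big ≤-refl))))
                   (extension-hi E)
      -- The new tooth begins with `c` and contains it only once, so no big letter precedes `c`.
      hi-x : ∀ {h} → h ++ c ∷ hi v ≡ c ∷ teeth → h ≡ []
      hi-x {[]}    eq = refl
      hi-x {_ ∷ h} eq = contradiction (subst (c ∈_) (∷-injectiveʳ eq) (∈-insert h)) c∉teeth
      px : All (_< c) x
      px = All.tabulate λ a∈ → ≰⇒> λ c≤a →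
        contradiction (subst (_ ∈_) (hi-x hi-w) (∈-filter⁺ (c ≤?_) a∈ c≤a)) λ ()
      hi-v : hi v ≡ teeth
      hi-v = ∷-injectiveʳ (subst (λ h → h ++ c ∷ hi v ≡ c ∷ teeth) (hi-x hi-w) hi-w)
      y : List ℕ
      y = lo v
      E′ : Extension n (x ++ y)
      E′ = subst (Extension n) (lo-∷ x v px) (extension-lo E)
      -- A descent of old labels behind `c` would form a 321 with `c` as its largest letter.
      iy : Increasing y
      iy = no-inversion⇒increasing
        (Unique.filter⁺ (_<? c) (unique-++ʳ x E.unique))
        λ a<b p → E.avoid (proj₂ (∈-filter⁻ (_<? c) {xs = v} (lookup p (here refl)))) a<b
          (Sub.++⁺ˡ x (refl ∷ ⊆-trans p (lo-⊆ v)))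
        where
        unique-++ʳ : ∀ as {bs} → Unique (as ++ c ∷ bs) → Unique bs
        unique-++ʳ []       (_ ∷ u) = u
        unique-++ʳ (_ ∷ as) (_ ∷ u) = unique-++ʳ as u
      c∉v : c ∉ v
      c∉v c∈ = c∉teeth (subst (c ∈_) hi-v (∈-filter⁺ (c ≤?_) c∈ ≤-refl))
      -- The spine puts every earlier head before `c`.
      heads′ : ∀ {i} → i < n → i * t ∈ x
      heads′ i<n = ∈-before x c∉v (E.order (◁-spine i<n) (m<n+m c z<s))
      bM = Merge-surjective Z Y increasing
      b = proj₁ bM
      M : Merge b y teeth Z Y
      M = subst (λ z → Merge b y z Z Y) hi-v (proj₂ bM)
      m≡ : length x + length b ≡ m
      m≡ = suc-injective (trans (sym (trans (length-++ x) (trans (+-suc _ _)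
             (cong (λ l → suc (length x + l)) (length-Merge M))))) cut)
      |x|≤m : length x ≤ m
      |x|≤m = ≤-trans (m≤m+n _ _) (≤-reflexive m≡)
      |b|≡ : length b ≡ m ∸ length x
      |b|≡ = sym (trans (cong (_∸ length x) (sym m≡)) (m+n∸m≡n (length x) _))
      upper : trues b ≤ r
      upper = ≤-trans (trues≤ M) (≤-reflexive (length-applyUpTo _ r))
      lower : m ∸ c ≤ trues b
      lower = m≤n+o⇒m∸n≤o m c (begin
        m                                ≡⟨ m≡ ⟨
        length x + length b              ≡⟨ cong (length x +_) (trans (length-trues+falses b) (+-comm (trues b) _)) ⟩
        length x + (falses b + trues b)  ≡⟨ +-assoc (length x) _ _ ⟨
        length x + falses b + trues b    ≤⟨ +-monoˡ-≤ _ (+-monoʳ-≤ (length x) (falses≤ M)) ⟩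
        length x + length y + trues b    ≡⟨ cong (_+ trues b) (length-++ x) ⟨
        length (x ++ y) + trues b        ≡⟨ cong (_+ trues b) (Extension.size E′) ⟩
        c + trues b                      ∎)
        where open ≤-Reasoning

  -- For n ≥ 1 this is F (n + 1) t (m + 1); starting from n = 0 makes F 2 t an instance of the recursion.
  cuts : (n m : ℕ) → ℕ
  cuts zero    zero    = 1
  cuts zero    (suc m) = 0
  cuts (suc n) zero    = 0
  cuts (suc n) (suc m) = ∑[ i ∈ 0 ⋯ m ] (cuts n i * (∑[ j ∈ m ∸ n * t ⋯ r ] ((m ∸ i) C j)))

  -- In the step `i` is the length of the old `x`; pairs of a cut and a binary word are counted as a
  -- product, the words being grouped by their number of `true`.
  counted-cuts : ∀ n m → Counted (Cut n m) (cuts n m)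
  counted-cuts zero zero = counted-singleton ([] , [])
    (record
      { extension = record
        { unique = [] ; bounded = λ () ; covers = λ () ; order = λ _ () ; avoid = λ { _ _ () } }
      ; increasing = []
      ; cut = refl
      ; heads = λ () })
    (λ { {[] , []}    _ → refl
       ; {[] , y ∷ _} K → contradiction (Extension.bounded (Cut.extension K) (here refl)) λ ()
       ; {x ∷ _ , _}  K → contradiction (Extension.bounded (Cut.extension K) (here refl)) λ () })
  counted-cuts zero (suc m) = counted-∅
    λ { {[] , _}    K → contradiction (Cut.cut K) λ ()
      ; {x ∷ _ , _} K → contradiction (Extension.bounded (Cut.extension K) (here refl)) λ () }
  counted-cuts (suc n) zero = counted-∅
    λ { {[] , _}    K → contradiction (Cut.heads K z<s) λ ()
      ; {x ∷ _ , _} K → contradiction (Cut.cut K) λ () }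
  counted-cuts (suc n) (suc m) = counted-map insert
    (λ {p} (i , i≤m , I) → insert-cut p (s≤s⁻¹ i≤m) I)
    (λ {p} {q} (i , i≤m , I) (j , j≤m , J) → insert-injective p q (s≤s⁻¹ i≤m) (s≤s⁻¹ j≤m) I J)
    insert-surjective
    (counted-sum (Insertable m) _ (suc m)
      (λ (K , _) (K′ , _) → trans (sym (Cut.cut K)) (Cut.cut K′))
      λ i → counted-× (counted-cuts n i)
        (counted-⇔ (λ (p , q , s) → p , q , s) (λ (p , q , s) → p , q , s)
          (counted-∑ (λ b → length b ≡ m ∸ i) trues ((m ∸ i) C_) (m ∸ n * t) r
            (counted-binary (m ∸ i)))))
    where open Step n

-- Manipulating finite sums.

if-dec : {P A : Set} {x y z : A} (d : Dec P) → (P → x ≡ z) → (¬ P → y ≡ z) →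
         (if does d then x else y) ≡ z
if-dec (yes p) f g = f p
if-dec (no ¬p) f g = g ¬p

sum-cong : ∀ {f g : ℕ → ℕ} n → (∀ i → i < n → f i ≡ g i) → sum (applyUpTo f n) ≡ sum (applyUpTo g n)
sum-cong zero    h = refl
sum-cong (suc n) h = cong₂ _+_ (h 0 z<s) (sum-cong n (λ i i<n → h (suc i) (s<s i<n)))

sum-0 : ∀ {f : ℕ → ℕ} n → (∀ i → i < n → f i ≡ 0) → sum (applyUpTo f n) ≡ 0
sum-0 zero    h = refl
sum-0 (suc n) h = cong₂ _+_ (h 0 z<s) (sum-0 n (λ i i<n → h (suc i) (s<s i<n)))

sum-drop : ∀ {f : ℕ → ℕ} a n → (∀ i → i < a → f i ≡ 0) →
           sum (applyUpTo f n) ≡ sum (applyUpTo (λ d → f (a + d)) (n ∸ a))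
sum-drop zero    n       h = refl
sum-drop (suc a) zero    h = refl
sum-drop (suc a) (suc n) h = cong₂ _+_ (h 0 z<s) (sum-drop a n (λ i i<a → h (suc i) (s<s i<a)))

sum-take : ∀ {f : ℕ → ℕ} {k n} → k ≤ n → (∀ i → k ≤ i → f i ≡ 0) →
           sum (applyUpTo f n) ≡ sum (applyUpTo f k)
sum-take {n = n} z≤n h = sum-0 n (λ i _ → h i z≤n)
sum-take {f} (s≤s k≤n) h = cong (f 0 +_) (sum-take k≤n (λ i k≤i → h (suc i) (s≤s k≤i)))

∑-cong : ∀ {f g : ℕ → ℕ} a b → (∀ i → f i ≡ g i) → ∑ a b f ≡ ∑ a b g
∑-cong a b h = sum-cong (suc b ∸ a) (λ d _ → h (a + d))

∑-from : ∀ {f : ℕ → ℕ} a b → (∀ i → i < a → f i ≡ 0) → ∑ 0 b f ≡ ∑ a b f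
∑-from a b = sum-drop a (suc b)

∑-upto : ∀ {f : ℕ → ℕ} a {b c} → b ≤ c → (∀ i → b < i → f i ≡ 0) → ∑ a c f ≡ ∑ a b f
∑-upto a {b} b≤c h = sum-take (∸-monoˡ-≤ a (s≤s b≤c))
  (λ d len≤d → h (a + d) (≤-trans (m≤n+m∸n (suc b) a) (+-monoʳ-≤ a len≤d)))

∑-empty : ∀ (f : ℕ → ℕ) {a b} → b < a → ∑ a b f ≡ 0
∑-empty f {a} b<a = cong (λ n → sum (applyUpTo (λ d → f (a + d)) n)) (m≤n⇒m∸n≡0 b<a)

∑-single : ∀ (f : ℕ → ℕ) a → ∑ a a f ≡ f a
∑-single f a = trans (cong (λ n → sum (applyUpTo (λ d → f (a + d)) n)) (m+n∸n≡m 1 a))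
                     (trans (+-identityʳ _) (cong f (+-identityʳ a)))

-- The numbers `F` as counts of cuts.

module CutCounts (r : ℕ) where

  open Teeth r

  weight : ℕ → ℕ → ℕ → ℕ
  weight n m i = ∑[ j ∈ m ∸ n * t ⋯ r ] ((m ∸ i) C j)

  -- Every term of the recursion has a factor that vanishes by induction. Combinatorially, `x` is
  -- too short to hold `n` heads.
  cuts-low : ∀ {n m} → m < n → cuts n m ≡ 0
  cuts-low {suc n} {zero}  _         = refl
  cuts-low {suc n} {suc m} (s≤s m<n) = sum-0 (suc m)
    λ i i≤m → cong (_* weight n m i) (cuts-low (<-≤-trans i≤m m<n))

  -- The lower limit of the inner sum exceeds `r`, so that sum is empty. Combinatorially, `x` would
  -- be longer than the whole word.
  cuts-high : ∀ {n m} → n * t < m → cuts n m ≡ 0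
  cuts-high {zero}  {suc m} _         = refl
  cuts-high {suc n} {suc m} (s≤s t≤m) = sum-0 (suc m)
    λ i _ → trans (cong (cuts n i *_) (∑-empty ((m ∸ i) C_) (m+n≤o⇒m≤o∸n t t≤m)))
                  (*-zeroʳ (cuts n i))

  -- Only `i = 0` contributes, and in the inner sum only `j = m`: a single tooth has one linear
  -- extension.
  cuts-one : ∀ {m} → m ≤ r → cuts 1 (suc m) ≡ 1
  cuts-one {m} m≤r = begin
    ∑[ i ∈ 0 ⋯ m ] (cuts 0 i * (∑[ j ∈ m ⋯ r ] ((m ∸ i) C j)))
      ≡⟨ ∑-upto {λ i → cuts 0 i * weight 0 m i} 0 {0} {m} z≤n (λ { (suc i) _ → refl }) ⟩
    -- The two `+ 0` come from multiplying by `cuts 0 0`, which is 1, and from the end of the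
    -- one-term sum.
    (∑[ j ∈ m ⋯ r ] (m C j)) + 0 + 0
      ≡⟨ trans (+-identityʳ _) (+-identityʳ _) ⟩
    ∑[ j ∈ m ⋯ r ] (m C j)
      ≡⟨ ∑-upto m m≤r (λ j → k>n⇒nCk≡0) ⟩
    ∑[ j ∈ m ⋯ m ] (m C j)
      ≡⟨ ∑-single (m C_) m ⟩
    m C m
      ≡⟨ nCn≡1 m ⟩
    1 ∎
    where open ≡-Reasoning

  -- The range reads `n ≤ m ≤ n * t`; below it `cuts-low` applies and above it `cuts-high`.
  outside : ∀ {n m} → ¬ (suc n ≤ suc m × suc m ≤ n * t + 1) → 0 ≡ cuts n m
  outside {n} {m} ¬range with m <? n | m ≤? n * t
  ... | yes m<n | _        = sym (cuts-low m<n)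
  ... | no  m≮n | no  m≰nt = sym (cuts-high {n} (≰⇒> m≰nt))
  ... | no  m≮n | yes m≤nt = contradiction
    (s≤s (≮⇒≥ m≮n) , ≤-trans (s≤s m≤nt) (≤-reflexive (+-comm 1 (n * t)))) ¬range

  -- The argument `suc m` of `F` is the position of the next head, directly behind an `x` of length
  -- `m`.
  F≡cuts : ∀ n m → F (2 + n) t (suc m) ≡ cuts (suc n) m
  F≡cuts zero m = if-dec (2 ≤? suc m ×-dec suc m ≤? t + 1) (inside m)
    (λ ¬range → outside {1} (¬range ∘ λ (l , u) →
      l , subst (λ k → suc m ≤ k + 1) (+-identityʳ t) u))
    where
    inside : ∀ m → 2 ≤ suc m × suc m ≤ t + 1 → 1 ≡ cuts 1 m
    inside zero    (s≤s () , _)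
    inside (suc m) (_ , u) = sym (cuts-one {m} (s≤s⁻¹ (s≤s⁻¹ (≤-trans u (≤-reflexive (+-comm t 1))))))
  F≡cuts (suc n) zero    = refl
  F≡cuts (suc n) (suc m) =
    if-dec (3 + n ≤? 2 + m ×-dec 2 + m ≤? (2 + n) * t + 1) (λ _ → recursion) (outside {2 + n})
    where
    open ≡-Reasoning
    recursion :
      ∑[ i ∈ 2 + n ⋯ 1 + m ] (F (2 + n) t i * (∑[ j ∈ (2 + m) ∸ ((1 + n) * t + 2) ⋯ r ] ((2 + m ∸ i ∸ 1) C j)))
        ≡ cuts (2 + n) (suc m)
    recursion = begin
      -- Replacing `i` by `suc i` is mere computation: both limits drop by one, and so does the top
      -- of the binomial coefficient's subtraction.
      ∑[ i ∈ 1 + n ⋯ m ] (F (2 + n) t (suc i) * (∑[ j ∈ (2 + m) ∸ ((1 + n) * t + 2) ⋯ r ] ((1 + m ∸ i ∸ 1) C j)))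
        ≡⟨ ∑-cong (1 + n) m (λ i → cong₂ _*_ (F≡cuts n i)
             (cong₂ (λ a b → ∑[ j ∈ a ⋯ r ] (b C j))
               (cong (2 + m ∸_) (+-comm ((1 + n) * t) 2))
               (trans (∸-+-assoc (1 + m) i 1) (cong (1 + m ∸_) (+-comm i 1))))) ⟩
      ∑[ i ∈ 1 + n ⋯ m ] (cuts (1 + n) i * (∑[ j ∈ m ∸ (1 + n) * t ⋯ r ] ((m ∸ i) C j)))
        ≡⟨ ∑-from (1 + n) m (λ i i≤n → cong (_* weight (1 + n) m i) (cuts-low i≤n)) ⟨
      cuts (2 + n) (suc m) ∎

  -- When `x` is the whole word, both limits of the inner sum equal `r`, which leaves one binomial
  -- coefficient. The outer sum then shrinks to the range where `cuts` can be nonzero.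
  cuts-full : ∀ n → cuts (2 + n) ((2 + n) * t) ≡
              ∑[ k ∈ 2 + n ⋯ (1 + n) * t + 1 ] ((((2 + n) * t ∸ k) C r) * F (2 + n) t k)
  cuts-full n = begin
    ∑[ i ∈ 0 ⋯ r + u ] (cuts (1 + n) i * (∑[ j ∈ r + u ∸ u ⋯ r ] ((r + u ∸ i) C j)))
      ≡⟨ ∑-cong 0 (r + u) (λ i → trans
           (cong (cuts (1 + n) i *_) (trans
             (cong (λ a → ∑[ j ∈ a ⋯ r ] ((r + u ∸ i) C j)) (m+n∸n≡m r u))
             (∑-single ((r + u ∸ i) C_) r)))
           (*-comm (cuts (1 + n) i) _)) ⟩
    ∑[ i ∈ 0 ⋯ r + u ] (((r + u ∸ i) C r) * cuts (1 + n) i)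
      ≡⟨ ∑-from (1 + n) (r + u) (λ i i≤n →
           trans (cong (((r + u ∸ i) C r) *_) (cuts-low i≤n)) (*-zeroʳ ((r + u ∸ i) C r))) ⟩
    ∑[ i ∈ 1 + n ⋯ r + u ] (((r + u ∸ i) C r) * cuts (1 + n) i)
      ≡⟨ ∑-upto (1 + n) (m≤n+m u r) (λ i u<i →
           trans (cong (((r + u ∸ i) C r) *_) (cuts-high {1 + n} u<i)) (*-zeroʳ ((r + u ∸ i) C r))) ⟩
    ∑[ i ∈ 1 + n ⋯ u ] (((r + u ∸ i) C r) * cuts (1 + n) i)
      ≡⟨ ∑-cong (1 + n) u (λ i → cong (((r + u ∸ i) C r) *_) (sym (F≡cuts n i))) ⟩
    ∑[ k ∈ 2 + n ⋯ 1 + u ] ((((2 + n) * t ∸ k) C r) * F (2 + n) t k)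
      ≡⟨ cong (λ b → ∑[ k ∈ 2 + n ⋯ b ] ((((2 + n) * t ∸ k) C r) * F (2 + n) t k)) (+-comm 1 u) ⟩
    ∑[ k ∈ 2 + n ⋯ u + 1 ] ((((2 + n) * t ∸ k) C r) * F (2 + n) t k) ∎
    where
    open ≡-Reasoning
    u : ℕ
    u = (1 + n) * t

-- Vectors over `Fin n` as words of natural numbers.

module _ {n : ℕ} where

  labels : ∀ {m} → Vec (Fin n) m → List ℕ
  labels []      = []
  labels (a ∷ v) = toℕ a ∷ labels v

  length-labels : ∀ {m} (v : Vec (Fin n) m) → length (labels v) ≡ m
  length-labels []      = refl
  length-labels (a ∷ v) = cong suc (length-labels v)

  labels-injective : ∀ {m} (v w : Vec (Fin n) m) → labels v ≡ labels w → v ≡ w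
  labels-injective []      []      _  = refl
  labels-injective (a ∷ v) (b ∷ w) eq with a≡b , v≡w ← ∷-injective eq =
    cong₂ _∷_ (toℕ-injective a≡b) (labels-injective v w v≡w)

  labels-surjective : ∀ {m} xs → length xs ≡ m → (∀ {a} → a ∈ xs → a < n) →
                      ∃[ v ] labels {m} v ≡ xs
  labels-surjective []       refl _ = [] , refl
  labels-surjective (a ∷ xs) refl h with v , eq ← labels-surjective xs refl (h ∘ there) =
    fromℕ< (h (here refl)) ∷ v , cong₂ _∷_ (toℕ-fromℕ< (h (here refl))) eq

  lookup-∈ : ∀ {m} (v : Vec (Fin n) m) i → toℕ (Vec.lookup v i) ∈ labels v
  lookup-∈ (a ∷ v) zero    = here refl
  lookup-∈ (a ∷ v) (suc i) = there (lookup-∈ v i)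

  lookup-⊆₂ : ∀ {m} (v : Vec (Fin n) m) {i j} → i Fin.< j →
              toℕ (Vec.lookup v i) ∷ toℕ (Vec.lookup v j) ∷ [] ⊆ labels v
  lookup-⊆₂ (a ∷ v) {zero}  {suc j} _         = refl ∷ from∈ (lookup-∈ v j)
  lookup-⊆₂ (a ∷ v) {suc i} {suc j} (s≤s i<j) = _ ∷ʳ lookup-⊆₂ v i<j

  lookup-⊆₃ : ∀ {m} (v : Vec (Fin n) m) {i j k} → i Fin.< j → j Fin.< k →
              toℕ (Vec.lookup v i) ∷ toℕ (Vec.lookup v j) ∷ toℕ (Vec.lookup v k) ∷ [] ⊆ labels v
  lookup-⊆₃ (a ∷ v) {zero}  {suc j} {suc k} _         (s≤s j<k) = refl ∷ lookup-⊆₂ v j<k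
  lookup-⊆₃ (a ∷ v) {suc i} {suc j} {suc k} (s≤s i<j) (s≤s j<k) = _ ∷ʳ lookup-⊆₃ v i<j j<k

  ∈-index : ∀ {m} (v : Vec (Fin n) m) {a} → a ∈ labels v → ∃[ i ] toℕ (Vec.lookup v i) ≡ a
  ∈-index (b ∷ v) (here refl) = zero , refl
  ∈-index (b ∷ v) (there a∈)  with i , eq ← ∈-index v a∈ = suc i , eq

  ⊆₂-index : ∀ {m} (v : Vec (Fin n) m) {a b} → a ∷ b ∷ [] ⊆ labels v →
             ∃[ i ] ∃[ j ] i Fin.< j × toℕ (Vec.lookup v i) ≡ a × toℕ (Vec.lookup v j) ≡ b
  ⊆₂-index (x ∷ v) (_ ∷ʳ p)   with i , j , i<j , eqs ← ⊆₂-index v p = suc i , suc j , s≤s i<j , eqs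
  ⊆₂-index (x ∷ v) (refl ∷ p) with j , eq ← ∈-index v (to∈ p) = zero , suc j , z<s , refl , eq

  ⊆₃-index : ∀ {m} (v : Vec (Fin n) m) {a b c} → a ∷ b ∷ c ∷ [] ⊆ labels v →
             ∃[ i ] ∃[ j ] ∃[ k ] i Fin.< j × j Fin.< k ×
               toℕ (Vec.lookup v i) ≡ a × toℕ (Vec.lookup v j) ≡ b × toℕ (Vec.lookup v k) ≡ c
  ⊆₃-index (x ∷ v) (_ ∷ʳ p)   with i , j , k , i<j , j<k , eqs ← ⊆₃-index v p =
    suc i , suc j , suc k , s≤s i<j , s≤s j<k , eqs
  ⊆₃-index (x ∷ v) (refl ∷ p) with j , k , j<k , eqs ← ⊆₂-index v p =
    zero , suc j , suc k , z<s , s≤s j<k , refl , eqs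

  labels-bounded : ∀ {m} (v : Vec (Fin n) m) {a} → a ∈ labels v → a < n
  labels-bounded v a∈ with i , refl ← ∈-index v a∈ = toℕ<n (Vec.lookup v i)

  labels-unique⁺ : ∀ {m} {v : Vec (Fin n) m} → Vec.Unique v → Unique (labels v)
  labels-unique⁺ []       = []
  labels-unique⁺ (x∉ ∷ u) = distinct x∉ ∷ labels-unique⁺ u
    where
    distinct : ∀ {m x} {v : Vec (Fin n) m} → VecAll.All (x ≢_) v → All (toℕ x ≢_) (labels v)
    distinct []         = []
    distinct (x≢y ∷ x∉) = x≢y ∘ toℕ-injective ∷ distinct x∉

  labels-unique⁻ : ∀ {m} {v : Vec (Fin n) m} → Unique (labels v) → Vec.Unique v
  labels-unique⁻ {v = []}    []       = []
  labels-unique⁻ {v = _ ∷ _} (x∉ ∷ u) = distinct x∉ ∷ labels-unique⁻ u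
    where
    distinct : ∀ {m x} {v : Vec (Fin n) m} → All (toℕ x ≢_) (labels v) → VecAll.All (x ≢_) v
    distinct {v = []}    []         = []
    distinct {v = _ ∷ _} (x≢y ∷ x∉) = x≢y ∘ cong toℕ ∷ distinct x∉

  -- A missing label could be put in front of the word, giving `n + 1` distinct labels below `n`.
  labels-covers : {v : Vec (Fin n) n} → Unique (labels v) → ∀ {a} → a < n → a ∈ labels v
  labels-covers {v} u {a} a<n with a ∈? labels v
  ... | yes a∈ = a∈
  ... | no  a∉ = contradiction
    (subst₂ (λ l m → suc l ≤ m) (length-labels v) (length-applyUpTo id n)
      (unique-length-≤ (All.tabulate (λ { b∈ refl → a∉ b∈ }) ∷ u)
        λ { (here refl) → ∈-upTo⁺ a<n ; (there b∈) → ∈-upTo⁺ (labels-bounded v b∈) }))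
    (n≮n n)

  -- Turns the definition of `A₃₂₁` into a `Counted`, because `words n m` lists every vector exactly
  -- once.
  counted-filter-words : ∀ {m} {P : Vec (Fin n) m → Set} (P? : ∀ v → Dec (P v)) →
                         Counted P (length (filter P? (words n m)))
  counted-filter-words {m} {P} P? = record
    { elements = filter P? (words n m)
    ; unique   = Unique.filter⁺ P? (words-unique m)
    ; sound    = proj₂ ∘ ∈-filter⁻ P? {xs = words n m}
    ; complete = λ {v} → ∈-filter⁺ P? (∈-words v)
    ; size     = refl
    }
    where
    words-unique : ∀ m → Unique (words n m)
    words-unique zero    = [] ∷ []
    words-unique (suc m) = Unique.cartesianProductWith⁺ _∷_ Vec.∷-injective (Unique.allFin⁺ n) (words-unique m)
    ∈-words : ∀ {m} (v : Vec (Fin n) m) → v ∈ words n m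
    ∈-words []      = here refl
    ∈-words (a ∷ v) = ∈-cartesianProductWith⁺ _∷_ (∈-allFin a) (∈-words v)

-- The comb order of the statement and its form on labels.

module CombWords (s r : ℕ) where

  open Teeth r
  open LabeledPoset (Kᵝ s t) using (_⊏_)
  open Comb s t

  toℕ-label : (i : Fin s) (j : Fin t) → toℕ (combine i j) ≡ toℕ i * t + toℕ j
  toℕ-label i j = trans (toℕ-combine i j) (cong (_+ toℕ j) (*-comm t (toℕ i)))

  same-tooth⇒◁ : (i : Fin s) (j : Fin t) (i′ : Fin s) (j′ : Fin t) →
                 i ≡ i′ × toℕ j ≤ toℕ j′ → combine i j ≢ combine i′ j′ →
                 toℕ i * t + toℕ j ◁ toℕ i′ * t + toℕ j′
  same-tooth⇒◁ i j _ j′ (refl , j≤j′) distinct =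
    tooth (toℕ i) (≤∧≢⇒< j≤j′ (distinct ∘ cong (combine i) ∘ toℕ-injective)) (toℕ<n j′)

  Below⇒◁ : (i : Fin s) (j : Fin t) (i′ : Fin s) (j′ : Fin t) →
            Below (i , j) (i′ , j′) → combine i j ≢ combine i′ j′ →
            toℕ i * t + toℕ j ◁ toℕ i′ * t + toℕ j′
  Below⇒◁ i j i′ j′ (inj₁ same) distinct = same-tooth⇒◁ i j i′ j′ same distinct
  Below⇒◁ i j i′ j′ (inj₂ (j≡0 , i≤i′)) distinct with m≤n⇒m<n∨m≡n i≤i′
  ... | inj₁ i<i′ = subst (_◁ toℕ i′ * t + toℕ j′)
    (sym (trans (cong (toℕ i * t +_) j≡0) (+-identityʳ _))) (spine i<i′ (toℕ<n j′))
  -- The two cases of `Below` overlap when a head is compared within its own tooth; `_◁_` treats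
  -- this as a `tooth` relation.
  ... | inj₂ i≡i′ = same-tooth⇒◁ i j i′ j′
    (toℕ-injective i≡i′ , subst (_≤ toℕ j′) (sym j≡0) z≤n) distinct

  ⊏⇒◁ : ∀ {x y} → x ⊏ y → toℕ x ◁ toℕ y
  ⊏⇒◁ {x} {y} (x≼y , x≢y) = subst₂ _◁_ (toℕ≡ x) (toℕ≡ y)
    (Below⇒◁ _ _ _ _ (≼⇒Below x≼y) λ eq → x≢y
      (trans (sym (combine-remQuot {s} t x)) (trans eq (combine-remQuot {s} t y))))
    where
    toℕ≡ : ∀ z → toℕ (proj₁ (remQuot {s} t z)) * t + toℕ (proj₂ (remQuot {s} t z)) ≡ toℕ z
    toℕ≡ z = trans (sym (toℕ-label (proj₁ (remQuot {s} t z)) _)) (cong toℕ (combine-remQuot {s} t z))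

  label : ∀ {i j} → i < s → j < t → Fin (s * t)
  label i<s j<t = combine (fromℕ< i<s) (fromℕ< j<t)

  toℕ-label′ : ∀ {i j} (i<s : i < s) (j<t : j < t) → toℕ (label i<s j<t) ≡ i * t + j
  toℕ-label′ i<s j<t = trans (toℕ-label (fromℕ< i<s) (fromℕ< j<t))
    (cong₂ (λ a b → a * t + b) (toℕ-fromℕ< i<s) (toℕ-fromℕ< j<t))

  Below⇒⊏ : ∀ {i j i′ j′} (i<s : i < s) (j<t : j < t) (i′<s : i′ < s) (j′<t : j′ < t) →
            Below (fromℕ< i<s , fromℕ< j<t) (fromℕ< i′<s , fromℕ< j′<t) →
            i * t + j ≢ i′ * t + j′ → label i<s j<t ⊏ label i′<s j′<t
  Below⇒⊏ i<s j<t i′<s j′<t below ≢ =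
    subst₂ _≼_ (sym (remQuot-combine (fromℕ< i<s) _)) (sym (remQuot-combine (fromℕ< i′<s) _)) (Below⇒≼ below) ,
    λ eq → ≢ (trans (sym (toℕ-label′ i<s j<t)) (trans (cong toℕ eq) (toℕ-label′ i′<s j′<t)))

  tooth-index : ∀ i {j} → i * t + j < s * t → i < s
  tooth-index i {j} h = *-cancelʳ-< t i s (≤-<-trans (m≤m+n (i * t) j) h)

  -- `_◁_` does not limit the tooth index. The bound on `b` does, and on the spine the lower index
  -- inherits it from the upper one.
  ◁⇒⊏ : ∀ {a b} → a ◁ b → b < s * t → ∃[ x ] ∃[ y ] x ⊏ y × toℕ x ≡ a × toℕ y ≡ b
  ◁⇒⊏ a◁b@(tooth i {j} {j′} j<j′ j′<t) b< =
    label i<s j<t , label i<s j′<t ,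
    Below⇒⊏ i<s j<t i<s j′<t
      (inj₁ (refl , subst₂ _≤_ (sym (toℕ-fromℕ< j<t)) (sym (toℕ-fromℕ< j′<t)) (<⇒≤ j<j′)))
      (<⇒≢ (◁⇒< a◁b)) ,
    toℕ-label′ i<s j<t , toℕ-label′ i<s j′<t
    where
    i<s = tooth-index i b<
    j<t = <-trans j<j′ j′<t
  ◁⇒⊏ a◁b@(spine {i} {i′} {j′} i<i′ j′<t) b< =
    label i<s z<s , label i′<s j′<t ,
    Below⇒⊏ i<s z<s i′<s j′<t
      (inj₂ (refl , subst₂ _≤_ (sym (toℕ-fromℕ< i<s)) (sym (toℕ-fromℕ< i′<s)) (<⇒≤ i<i′)))
      (λ eq → <⇒≢ (◁⇒< a◁b) (trans (sym (+-identityʳ _)) eq)) ,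
    trans (toℕ-label′ i<s z<s) (+-identityʳ _) , toℕ-label′ i′<s j′<t
    where
    i′<s = tooth-index i′ b<
    i<s  = <-trans i<i′ i′<s

  Avoider : Vec (Fin (s * t)) (s * t) → Set
  Avoider v = IsLinearExtension (Kᵝ s t) v × ¬ Contains321 v

  avoider⇒extension : ∀ {v} → Avoider v → Extension s (labels v)
  avoider⇒extension {v} ((perm , precedes) , avoids) = record
    { unique  = labels-unique⁺ perm
    ; bounded = labels-bounded v
    ; covers  = labels-covers (labels-unique⁺ perm)
    ; order   = order
    ; avoid   = avoid
    }
    where
    order : ∀ {a b} → a ◁ b → b < s * t → a ∷ b ∷ [] ⊆ labels v
    order a◁b b< with x , y , x⊏y , refl , refl ← ◁⇒⊏ a◁b b<
                 with i , j , i<j , refl , refl ← precedes x y x⊏y = lookup-⊆₂ v i<j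
    avoid : ∀ {a b c} → b < a → c < b → ¬ a ∷ b ∷ c ∷ [] ⊆ labels v
    avoid b<a c<b p with i , j , k , i<j , j<k , refl , refl , refl ← ⊆₃-index v p =
      avoids (i , j , k , i<j , j<k , b<a , c<b)

  extension⇒avoider : ∀ {v} → Extension s (labels v) → Avoider v
  extension⇒avoider {v} E =
    (labels-unique⁻ unique , precedes) ,
    λ (i , j , k , i<j , j<k , b<a , c<b) → avoid b<a c<b (lookup-⊆₃ v i<j j<k)
    where
    open Extension E
    precedes : ∀ x y → x ⊏ y → Precedes v x y
    precedes x y x⊏y with i , j , i<j , ≡x , ≡y ← ⊆₂-index v (order (⊏⇒◁ x⊏y) (toℕ<n y)) =
      i , j , i<j , toℕ-injective ≡x , toℕ-injective ≡y

  avoider⇒cut : ∀ {v} → Avoider v → Cut s (s * t) (labels v , [])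
  avoider⇒cut {v} A = record
    { extension  = subst (Extension s) (sym (++-identityʳ _)) E
    ; increasing = []
    ; cut        = length-labels v
    ; heads      = λ i<s → Extension.covers E (*t-mono-< i<s)
    }
    where
    E : Extension s (labels v)
    E = avoider⇒extension A

  -- `x` already has all `s * t` letters, so `y` is empty.
  cut⇒avoider : ∀ {xy} → Cut s (s * t) xy → ∃[ v ] Avoider v × (labels v , []) ≡ xy
  cut⇒avoider {x , y} K = go y refl
    where
    open Cut K using (extension; cut)
    go : ∀ z → y ≡ z → ∃[ v ] Avoider v × (labels v , []) ≡ (x , y)
    go []      refl with E ← subst (Extension s) (++-identityʳ x) extension
                    with v , eq ← labels-surjective x cut (Extension.bounded E) =
      v , extension⇒avoider (subst (Extension s) (sym eq) E) , cong (_, []) eq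
    go (a ∷ z) refl = contradiction
      (trans (sym (length-++ x)) (trans (Extension.size extension) (sym cut)))
      (m+1+n≢m (length x))

  -- Avoiders correspond to the cuts of full length, and two enumerations of these have equal size.
  A₃₂₁≡cuts : A₃₂₁ (Kᵝ s t) ≡ cuts s (s * t)
  A₃₂₁≡cuts = counted-unique
    (counted-map (λ v → labels v , []) avoider⇒cut
      (λ _ _ eq → labels-injective _ _ (cong proj₁ eq)) cut⇒avoider
      (counted-filter-words λ w → isLinearExtension? (Kᵝ s t) w ×-dec ¬? (contains321? w)))
    (counted-cuts s (s * t))

theorem5 : (s t : ℕ) → 2 ≤ s → 2 ≤ t →
    A₃₂₁ (Kᵝ s t) ≡ ∑[ k ∈ s ⋯ (s ∸ 1) * t + 1 ] (((s * t ∸ k) C (t ∸ 1)) * F s t k)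
theorem5 (suc (suc n)) (suc r) (s≤s (s≤s z≤n)) _ =
  trans (CombWords.A₃₂₁≡cuts (2 + n) r) (CutCounts.cuts-full r n)
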